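{- Let $n$ be a positive integer, let $R$ be a simply connected region, and let $\alpha$ and $\beta$ be two order-$n$ ribbon tilings of $R$. Then: (a) $\alpha$ and $\beta$ contain the same number of tiles of each level; thus $t_{c,i}(\alpha)$ is defined if and only if $t_{c,i}(\beta)$ is defined. (b) If $c\equiv d\pmod n$ (and $t_{c,i}$, $t_{d,j}$ are defined), then $t_{c,i}(\alpha)\prec t_{d,j}(\alpha)$ if and only if $t_{c,i}(\beta)\prec t_{d,j}(\beta)$. (c) If $b\in B_R$ (and $t_{c,i}$ is defined), then $t_{c,i}(\alpha)\prec b$ if and only if $t_{c,i}(\beta)\prec b$, and $b\prec t_{c,i}(\alpha)$ if and only if $b\prec t_{c,i}(\beta)$.
   Context: Squares of the grid $\mathbb Z^2$ are indexed by integer pairs; $s_{x,y}$ is the unit square at position $(x,y)$. Two squares are adjacent if they share an edge. The square $s_{x,y}$ has level $x+y$ and color $x+y \bmod n$. A ribbon tile of order $n$ is a connected (via adjacency) set of squares containing exactly one square of each of the $n$ colors (equivalently, a sequence of $n$ squares each directly above or directly to the right of its predecessor). A tile has level $c$ if $c$ is the level of its lowest-level square. A region $R$ is a finite set of squares connected via adjacency; it is simply connected if for every square $s\notin R$ there is no connected cycle of squares in $R$ that encircles $s$ with non-zero winding number. An order-$n$ ribbon tiling of $R$ is a partition of $R$ into ribbon tiles of order $n$. $B_R$ is the set of squares not in $R$ that are adjacent to at least one square of $R$. The relation $\prec$: $s_{x,y}$ is directly left of $s_{x',y'}$ if $x+y=x'+y'$ and $x<x'$; it is indirectly left of $s_{x',y'}$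 if $|(x+y)-(x'+y')|=1$, $x\le x'$ and $y\ge y'$. Write $s\prec s'$ for squares if $s$ is directly or indirectly left of $s'$. For a tile $t$ and a square $s$: $s\prec t$ if $s\prec s'$ for some $s'\in t$, and $t\prec s$ if $s'\prec s$ for some $s'\in t$. For distinct tiles $t_1,t_2$ of a tiling: $t_1\prec t_2$ if $s_1\prec s_2$ for some $s_1\in t_1$, $s_2\in t_2$. For a tiling $\alpha$, $t_{c,i}(\alpha)$ ($i\ge1$) denotes the $i$-th tile of $\alpha$ of level $c$, counted from left to right (so $t_{c,i}(\alpha)\prec t_{c,i+1}(\alpha)$), when such a tile exists. -}

module Defs where

open import Data.Bool using (if_then_else_; _∧_)
open import Data.Fin using (toℕ)
open import Data.Integer using (ℤ; 0ℤ; 1ℤ; -1ℤ; ∣_∣; _+_; _-_; _≤_; _<_; _≥_)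
  renaming (suc to sucℤ)
open import Data.Integer.DivMod using (_%ℕ_)
open import Data.Integer.Properties using (_≟_; _≤?_; _<?_)
open import Data.List using (List; length; filter; lookup)
open import Data.List.Membership.Propositional using (_∈_; _∉_)
open import Data.List.Relation.Binary.Disjoint.Propositional using (Disjoint)
open import Data.List.Relation.Binary.Permutation.Propositional using (_↭_)
open import Data.List.Relation.Unary.All using (All; all?)
open import Data.List.Relation.Unary.AllPairs using (AllPairs)
open import Data.List.Relation.Unary.Any using (Any; any?)
open import Data.List.Relation.Unary.Linked using (Linked)
open import Data.Nat as ℕ using (ℕ; NonZero)
open import Data.Product using (∃; ∃-syntax; ∃!; _×_; _,_)
open import Data.Sum using (_⊎_)
open import Function.Bundles using (_⇔_)
open import Relation.Binary.Construct.Closure.ReflexiveTransitive using (Star; ε; _◅_)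
open import Relation.Binary.PropositionalEquality using (_≡_; _≢_)
open import Relation.Nullary.Decidable using (Dec; ⌊_⌋; _×-dec_)

Square : Set
Square = ℤ × ℤ

level : Square → ℤ
level (x , y) = x + y

color : (n : ℕ) .{{_ : NonZero n}} → Square → ℕ
color n s = level s %ℕ n

data Adjacent : Square → Square → Set where
  east  : ∀ {x y} → Adjacent (x , y) (sucℤ x , y)
  west  : ∀ {x y} → Adjacent (sucℤ x , y) (x , y)
  north : ∀ {x y} → Adjacent (x , y) (x , sucℤ y)
  south : ∀ {x y} → Adjacent (x , sucℤ y) (x , y)

-- Finite sets of squares are lists read up to membership: the order and the
-- multiplicity of the entries are irrelevant.
SquareSet : Set
SquareSet = List Square

StepIn : SquareSet → Square → Square → Set
StepIn S s s′ = s ∈ S × s′ ∈ S × Adjacent s s′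

Walk : SquareSet → Square → Square → Set
Walk S = Star (StepIn S)

Connected : SquareSet → Set
Connected S = ∀ {s s′} → s ∈ S → s′ ∈ S → Walk S s s′

-- Signed crossings of the horizontal ray running to the right from the
-- midpoint of the segment between the centres of (a , b) and (a , b + 1); a
-- walk is the polygonal path through the centres of its squares.
crossing : Square → ∀ {s s′} → Adjacent s s′ → ℤ
crossing _       east            = 0ℤ
crossing _       west            = 0ℤ
crossing (a , b) (north {x} {y}) = if ⌊ a <? x ⌋ ∧ ⌊ y ≟ b ⌋ then 1ℤ else 0ℤ
crossing (a , b) (south {x} {y}) = if ⌊ a <? x ⌋ ∧ ⌊ y ≟ b ⌋ then -1ℤ else 0ℤ

-- For a closed walk avoiding p this is its winding number around the centre
-- of p: such a walk never runs along the segment from that centre to the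
-- start of the ray.
winding : Square → ∀ {S s s′} → Walk S s s′ → ℤ
winding _ ε                 = 0ℤ
winding p ((_ , _ , a) ◅ w) = crossing p a + winding p w

record SimplyConnectedRegion (R : SquareSet) : Set where
  field
    connected : Connected R
    noHoles   : ∀ {s} → s ∉ R → ∀ {s₀} (w : Walk R s₀ s₀) → winding s w ≡ 0ℤ

Boundary : SquareSet → Square → Set
Boundary R b = b ∉ R × (∃[ s ] s ∈ R × Adjacent b s)

record RibbonTile (n : ℕ) .{{_ : NonZero n}} (t : SquareSet) : Set where
  field
    connected : Connected t
    colors    : ∀ k → k ℕ.< n → ∃! _≡_ (λ s → s ∈ t × color n s ≡ k)

record RibbonTiling (n : ℕ) .{{_ : NonZero n}}
                    (R : SquareSet) (α : List SquareSet) : Set where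
  field
    ribbons  : All (RibbonTile n) α
    disjoint : AllPairs Disjoint α
    covers   : ∀ s → s ∈ R ⇔ Any (s ∈_) α

HasLevel : ℤ → SquareSet → Set
HasLevel c t = Any (λ s → level s ≡ c) t × All (λ s → c ≤ level s) t

hasLevel? : ∀ c t → Dec (HasLevel c t)
hasLevel? c t = any? (λ s → level s ≟ c) t ×-dec all? (λ s → c ≤? level s) t

tilesOfLevel : ℤ → List SquareSet → List SquareSet
tilesOfLevel c = filter (hasLevel? c)

DirectlyLeft : Square → Square → Set
DirectlyLeft s@(x , _) s′@(x′ , _) = level s ≡ level s′ × x < x′

IndirectlyLeft : Square → Square → Set
IndirectlyLeft s@(x , y) s′@(x′ , y′) =
  ∣ level s - level s′ ∣ ≡ 1 × x ≤ x′ × y ≥ y′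

infix 4 _≺_ _≺ᵗˢ_ _≺ˢᵗ_ _≺ᵗ_

_≺_ : Square → Square → Set
s ≺ s′ = DirectlyLeft s s′ ⊎ IndirectlyLeft s s′

_≺ᵗˢ_ : SquareSet → Square → Set
t ≺ᵗˢ s = Any (_≺ s) t

_≺ˢᵗ_ : Square → SquareSet → Set
s ≺ˢᵗ t = Any (s ≺_) t

-- Only used for tiles of one tiling: these are non-empty and pairwise
-- disjoint, so they differ as lists exactly when they differ as sets.
_≺ᵗ_ : SquareSet → SquareSet → Set
t₁ ≺ᵗ t₂ = t₁ ≢ t₂ × Any (λ s₁ → Any (s₁ ≺_) t₂) t₁

record LeftToRight (α : List SquareSet) (c : ℤ) (ts : List SquareSet) : Set where
  field
    tiles   : ts ↭ tilesOfLevel c α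
    ordered : Linked _≺ᵗ_ ts

-- IsTile α c i t says that t_{c,i}(α) is defined and equal to t; the index i
-- starts at 1.
IsTile : List SquareSet → ℤ → ℕ → SquareSet → Set
IsTile α c i t =
  ∃[ ts ] LeftToRight α c ts
        × (∃[ k ] ℕ.suc (toℕ {length ts} k) ≡ i × lookup ts k ≡ t)

IsDefined : List SquareSet → ℤ → ℕ → Set
IsDefined α c i = ∃ (IsTile α c i)

{-# OPTIONS --safe #-}
-- Let δ be the indicator of the squares of level l with a property Q, and
-- suppose that some φ satisfies φ s′ = φ s + δ s for every step of R from s up
-- or right to s′.  With γ k = [k ≡ c mod n], the sum of
-- γ (level s + 1) (φ + δ) s − γ (level s) φ s telescopes along a tile of level
-- c′ to γ c′ times the sum of δ over the tile.  Summing over R, the number of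
-- tiles of level c that have a square of level l with Q depends on R only.
-- (a) Take Q always true and φ = [level > l].
-- (c) If p ∉ R, winding numbers around p vanish on the closed walks of R, hence
-- they provide φ for Q = "right of p".  So the number of level-c tiles to the
-- right of p is an invariant, and these are the last tiles of level c.
-- (b) Only d = c and d = c ± n matter.  For d = c + n, look at the strip of the
-- levels d − 1 and d.  A tile passing through it has both its strip squares on
-- the same side of the first square u of t_{d,j}, so (number of level-c tiles) −
-- (number of level-d tiles) right of u is a count of squares of R.  By the
-- invariance used for (c), the strip between the squares u of α and of β lies in
-- R, where squares of both levels alternate, so these counts agree.
module Submission where

open import Defs
open import Data.Bool using (true; false; if_then_else_; _∧_)
open import Data.Fin using (Fin; zero; suc; toℕ; fromℕ<; inject₁)
open import Data.Fin.Properties using (toℕ<n; toℕ-fromℕ<; toℕ-inject₁)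
open import Data.Integer as ℤ using (ℤ; 0ℤ; 1ℤ; -1ℤ; +_; ∣_∣; _+_; _-_; _*_; _≤_; _<_; +≤+; +<+)
  renaming (suc to sucℤ)
open import Data.Integer.DivMod using (_%ℕ_; _/ℕ_; n%ℕd<d; a≡a%ℕn+[a/ℕn]*n)
open import Data.Integer.Properties
open import Data.Integer.Tactic.RingSolver using (solve)
open import Data.List
  using (List; []; _∷_; _++_; foldr; concat; map; applyUpTo; deduplicate; filter; length; lookup)
open import Data.List.Extrema ≤-totalOrder using (argmin; f[argmin]≤f[xs]; argmin-sel)
open import Data.List.Membership.Propositional using (_∈_; _∉_; find; lose)
open import Data.List.Membership.Propositional.Properties
  using (∈-deduplicate⁺; ∈-deduplicate⁻; ∈-concat⁺′; ∈-concat⁻′; ∈-map⁺; ∈-map⁻;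
         ∈-applyUpTo⁺; ∈-applyUpTo⁻; ∈-filter⁻; ∈-lookup)
open import Data.List.Membership.Propositional.Properties.WithK using (unique∧set⇒bag)
open import Data.List.Properties using (filter-all; length-filter)
open import Data.List.Relation.Binary.BagAndSetEquality using (∼bag⇒↭)
open import Data.List.Relation.Binary.Disjoint.Propositional using (Disjoint)
open import Data.List.Relation.Binary.Permutation.Propositional as ↭ using (_↭_)
open import Data.List.Relation.Binary.Permutation.Propositional.Properties
  using (↭-length; filter-↭; ∈-resp-↭; All-resp-↭)
open import Data.List.Relation.Unary.All as All using (All)
import Data.List.Relation.Unary.All.Properties as Allₚ
open import Data.List.Relation.Unary.AllPairs as AllPairs using (AllPairs)
import Data.List.Relation.Unary.AllPairs.Properties as AllPairsₚ
open import Data.List.Relation.Unary.Any as Any using (Any; any?; here; there)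
open import Data.List.Relation.Unary.Linked as Linked using (Linked)
open import Data.List.Relation.Unary.Unique.Propositional using (Unique)
import Data.List.Relation.Unary.Unique.Propositional.Properties as Unique
open import Data.Nat as ℕ using (ℕ; zero; suc; NonZero; z≤n; s≤s)
import Data.Nat.Properties as ℕ
open import Data.Product using (∃₂; ∃-syntax; _×_; _,_; proj₁; proj₂; swap)
open import Data.Product.Properties using (≡-dec)
open import Data.Sum using (_⊎_; inj₁; inj₂)
open import Data.Unit using (⊤; tt)
open import Function.Bundles using (_⇔_; mk⇔; Equivalence)
open import Relation.Binary.Construct.Closure.ReflexiveTransitive using (ε; _◅_; _◅◅_)
open import Relation.Binary.Definitions using (DecidableEquality; tri<; tri≈; tri>)
open import Relation.Binary.PropositionalEquality
open import Relation.Nullary using (Dec; yes; no; ¬_; contradiction)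
open import Relation.Nullary.Decidable using (⌊_⌋; _×-dec_; decidable-stable)
open import Relation.Unary using (Decidable)

-- Integer arithmetic

infixr 5 _⊕_

_⊕_ : ∀ {a b c d} → a ≤ b → c ≤ d → a + c ≤ b + d
_⊕_ = +-mono-≤

-- The pattern behind the linear inequalities below: the hypotheses are added up with `_⊕_`, and the
-- ring solver checks that the sum and the goal have the same gap between their sides.
≤-from : ∀ {a b c d} → a ≤ b → b - a ≡ d - c → c ≤ d
≤-from a≤b eq = 0≤i-j⇒j≤i (subst (0ℤ ≤_) eq (i≤j⇒0≤j-i a≤b))

<-from : ∀ {a b c d} → a ≤ b → b - a ≡ d - (1ℤ + c) → c < d
<-from a≤b eq = suc[i]≤j⇒i<j (≤-from a≤b eq)

below : ∀ {i j} → i < j → 1ℤ + i ≤ j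
below = i<j⇒suc[i]≤j

≡⇒≤ : ∀ {i j} → i ≡ j → i ≤ j
≡⇒≤ = ≤-reflexive

≡⇒≥ : ∀ {i j} → i ≡ j → j ≤ i
≡⇒≥ e = ≤-reflexive (sym e)

+-cancelˡ-≡ : ∀ i {j k} → i + j ≡ i + k → j ≡ k
+-cancelˡ-≡ i {j} {k} e =
  ≤-antisym (≤-from (≡⇒≤ e) (solve (i ∷ j ∷ k ∷ []))) (≤-from (≡⇒≥ e) (solve (i ∷ j ∷ k ∷ [])))

i+[j-i]≡j : ∀ i j → i + (j - i) ≡ j
i+[j-i]≡j i j = solve (i ∷ j ∷ [])

1+[i+j]≡i+[1+j] : ∀ i j → 1ℤ + (i + j) ≡ i + (1ℤ + j)
1+[i+j]≡i+[1+j] i j = solve (i ∷ j ∷ [])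

i<j+k⇒i-j<k : ∀ i j k → i < j + k → i - j < k
i<j+k⇒i-j<k i j k h = <-from (below h) (solve (i ∷ j ∷ k ∷ []))

i<j⇒i≤j-1 : ∀ {i j} → i < j → i ≤ j - 1ℤ
i<j⇒i≤j-1 {i} {j} h = ≤-from (below h) (solve (i ∷ j ∷ []))

i<1+j⇒i≤j : ∀ {i j} → i < 1ℤ + j → i ≤ j
i<1+j⇒i≤j {i} {j} h = ≤-from (below h) (solve (i ∷ j ∷ []))

i≤j⇒i<1+j : ∀ {i j} → i ≤ j → i < 1ℤ + j
i≤j⇒i<1+j {i} {j} h = <-from h (solve (i ∷ j ∷ []))

1+i≤1+j⇒i≤j : ∀ {i j} → 1ℤ + i ≤ 1ℤ + j → i ≤ j
1+i≤1+j⇒i≤j {i} {j} h = ≤-from h (solve (i ∷ j ∷ []))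

i+j≡k+m⇒m≤j : ∀ {i j k m} → i + j ≡ k + m → i ≤ k → m ≤ j
i+j≡k+m⇒m≤j {i} {j} {k} {m} e h = ≤-from (≡⇒≥ e ⊕ h) (solve (i ∷ j ∷ k ∷ m ∷ []))

i+j≤1+k+m⇒i≤k : ∀ {i j k m} → i + j ≤ 1ℤ + (k + m) → m < j → i ≤ k
i+j≤1+k+m⇒i≤k {i} {j} {k} {m} h h′ = ≤-from (h ⊕ below h′) (solve (i ∷ j ∷ k ∷ m ∷ []))

i+j≤1+k+m⇒j≤m : ∀ {i j k m} → i + j ≤ 1ℤ + (k + m) → k < i → j ≤ m
i+j≤1+k+m⇒j≤m {i} {j} {k} {m} h h′ = ≤-from (h ⊕ below h′) (solve (i ∷ j ∷ k ∷ m ∷ []))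

i-j≡1⇒ : ∀ {i j} → i - j ≡ 1ℤ → i ≡ 1ℤ + j
i-j≡1⇒ {i} {j} e = ≤-antisym (≤-from (≡⇒≤ e) (solve (i ∷ j ∷ []))) (≤-from (≡⇒≥ e) (solve (i ∷ j ∷ [])))

i-j≡-1⇒ : ∀ {i j} → i - j ≡ -1ℤ → j ≡ 1ℤ + i
i-j≡-1⇒ {i} {j} e = ≤-antisym (≤-from (≡⇒≥ e) (solve (i ∷ j ∷ []))) (≤-from (≡⇒≤ e) (solve (i ∷ j ∷ [])))

i≡1+j⇒ : ∀ {i j} → i ≡ 1ℤ + j → i - j ≡ 1ℤ
i≡1+j⇒ {j = j} refl = solve (j ∷ [])

j≡1+i⇒ : ∀ {i j} → j ≡ 1ℤ + i → i - j ≡ -1ℤ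
j≡1+i⇒ {i} refl = solve (i ∷ [])

i<i+n : ∀ n .{{_ : NonZero n}} i → i < i + + n
i<i+n n i = subst (_< i + + n) (+-identityʳ i) (+-monoʳ-< i (+<+ (ℕ.>-nonZero⁻¹ n)))

small-multiple : ∀ n .{{_ : NonZero n}} z → z * + n < + n → ℤ.- + n < z * + n → z ≡ 0ℤ
small-multiple n@(suc _) z hi lo = ≤-antisym
  (≤-from (below (*-cancelʳ-<-nonNeg {z} {1ℤ} (+ n) (subst (z * + n <_) (sym (*-identityˡ (+ n))) hi)))
     (solve (z ∷ [])))
  (≤-from (below (*-cancelʳ-<-nonNeg { -1ℤ} {z} (+ n) (subst (_< z * + n) (sym (-1*i≡-i (+ n))) lo)))
     (solve (z ∷ [])))

-- Equal remainders make a - b a multiple of n, and the two bounds place it strictly between - n and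
-- n.
%-injective : ∀ n .{{_ : NonZero n}} {a b} → a %ℕ n ≡ b %ℕ n → a < b + + n → b < a + + n → a ≡ b
%-injective n {a} {b} eq a<b+n b<a+n =
  i-j≡0⇒i≡j a b (trans diff (trans (cong (_* + n) (small-multiple n z hi lo)) (*-zeroˡ (+ n))))
  where
  z : ℤ
  z = a /ℕ n - b /ℕ n
  cancel : ∀ r p q m → r + p * m - (r + q * m) ≡ (p - q) * m
  cancel r p q m = solve (r ∷ p ∷ q ∷ m ∷ [])
  diff : a - b ≡ z * + n
  diff = trans
    (cong₂ _-_ (a≡a%ℕn+[a/ℕn]*n a n)
      (trans (a≡a%ℕn+[a/ℕn]*n b n) (cong (λ r → + r + (b /ℕ n) * + n) (sym eq))))
    (cancel (+ (a %ℕ n)) (a /ℕ n) (b /ℕ n) (+ n))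
  down : ∀ i j m → 1ℤ + j ≤ i + m → ℤ.- m < i - j
  down i j m h = <-from h (solve (i ∷ j ∷ m ∷ []))
  hi : z * + n < + n
  hi = subst (_< + n) diff (i<j+k⇒i-j<k a b (+ n) a<b+n)
  lo : ℤ.- + n < z * + n
  lo = subst (ℤ.- + n <_) diff (down a b (+ n) (below b<a+n))

-- The two remainders differ by a multiple of n, and remainders are less than n apart.
%-periodic : ∀ n .{{_ : NonZero n}} a → (a + + n) %ℕ n ≡ a %ℕ n
%-periodic n a = +-injective (i-j≡0⇒i≡j _ _
  (trans diff (trans (cong (_* + n) (small-multiple n z hi lo)) (*-zeroˡ (+ n)))))
  where
  r r′ : ℕ
  r  = (a + + n) %ℕ n
  r′ = a %ℕ n
  z : ℤ
  z = 1ℤ + a /ℕ n - (a + + n) /ℕ n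
  rearrange : ∀ s s′ q q′ m → s′ + q′ * m ≡ a → s + q * m ≡ a + m → s - s′ ≡ (1ℤ + q′ - q) * m
  rearrange s s′ q q′ m e′ e = trans (split s s′ q q′ m)
    (trans (cong₂ (λ u v → u - v + (q′ * m - q * m)) e e′) (join a q q′ m))
    where
    split : ∀ s s′ q q′ m → s - s′ ≡ s + q * m - (s′ + q′ * m) + (q′ * m - q * m)
    split s s′ q q′ m = solve (s ∷ s′ ∷ q ∷ q′ ∷ m ∷ [])
    join : ∀ a q q′ m → a + m - a + (q′ * m - q * m) ≡ (1ℤ + q′ - q) * m
    join a q q′ m = solve (a ∷ q ∷ q′ ∷ m ∷ [])
  diff : + r - + r′ ≡ z * + n
  diff = rearrange (+ r) (+ r′) ((a + + n) /ℕ n) (a /ℕ n) (+ n)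
    (sym (a≡a%ℕn+[a/ℕn]*n a n)) (sym (a≡a%ℕn+[a/ℕn]*n (a + + n) n))
  spread : ∀ i j m → 1ℤ + i ≤ m → 0ℤ ≤ j → i - j < m
  spread i j m h g = <-from (h ⊕ g) (solve (i ∷ j ∷ m ∷ []))
  spread′ : ∀ i j m → 1ℤ + j ≤ m → 0ℤ ≤ i → ℤ.- m < i - j
  spread′ i j m h g = <-from (h ⊕ g) (solve (i ∷ j ∷ m ∷ []))
  hi : z * + n < + n
  hi = subst (_< + n) diff (spread (+ r) (+ r′) (+ n) (below (+<+ (n%ℕd<d (a + + n) n))) (+≤+ z≤n))
  lo : ℤ.- + n < z * + n
  lo = subst (ℤ.- + n <_) diff (spread′ (+ r) (+ r′) (+ n) (below (+<+ (n%ℕd<d a n))) (+≤+ z≤n))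

-- Squares and ribbon tiles

infix 4 _↗_ _⊴_

data _↗_ : Square → Square → Set where
  east  : ∀ {x y} → (x , y) ↗ (sucℤ x , y)
  north : ∀ {x y} → (x , y) ↗ (x , sucℤ y)

↗⇒Adjacent : ∀ {s s′} → s ↗ s′ → Adjacent s s′
↗⇒Adjacent east  = east
↗⇒Adjacent north = north

level-↗ : ∀ {s s′} → s ↗ s′ → level s′ ≡ sucℤ (level s)
level-↗ (east {x} {y})  = +-assoc 1ℤ x y
level-↗ (north {x} {y}) = sym (1+[i+j]≡i+[1+j] x y)

↗-oriented : ∀ {s s′} → Adjacent s s′ → (s ↗ s′) ⊎ (s′ ↗ s)
↗-oriented east  = inj₁ east
↗-oriented west  = inj₂ east
↗-oriented north = inj₁ north
↗-oriented south = inj₂ north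

-- The order towards the south-east without the level condition of `≺`. Between distinct squares
-- that are `Near` each other it coincides with `≺`, and it is easier to propagate.
_⊴_ : Square → Square → Set
(x , y) ⊴ (x′ , y′) = x ≤ x′ × y′ ≤ y

Near : Square → Square → Set
Near s s′ = level s ≤ sucℤ (level s′) × level s′ ≤ sucℤ (level s)

⊴-antisym : ∀ {s s′} → s ⊴ s′ → s′ ⊴ s → s ≡ s′
⊴-antisym (p , q) (p′ , q′) = cong₂ _,_ (≤-antisym p p′) (≤-antisym q′ q)

≺⇒⊴ : ∀ {s s′} → s ≺ s′ → s ⊴ s′
≺⇒⊴ (inj₁ (e , x<x′)) = <⇒≤ x<x′ , i+j≡k+m⇒m≤j e (<⇒≤ x<x′)
≺⇒⊴ (inj₂ (_ , p , q)) = p , q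

∣i-j∣≡1⇒ : ∀ i j → ∣ i - j ∣ ≡ 1 → (i ≡ sucℤ j) ⊎ (j ≡ sucℤ i)
∣i-j∣≡1⇒ i j e with ∣i∣≡1⇒ (i - j) e
  where
  ∣i∣≡1⇒ : ∀ k → ∣ k ∣ ≡ 1 → (k ≡ 1ℤ) ⊎ (k ≡ -1ℤ)
  ∣i∣≡1⇒ (+ 1)       refl = inj₁ refl
  ∣i∣≡1⇒ ℤ.-[1+ 0 ] refl = inj₂ refl
... | inj₁ d = inj₁ (i-j≡1⇒ {i} {j} d)
... | inj₂ d = inj₂ (i-j≡-1⇒ {i} {j} d)

≺⇒Near : ∀ {s s′} → s ≺ s′ → Near s s′
≺⇒Near {s} {s′} (inj₁ (e , _)) = ≤-trans (≡⇒≤ e) (i≤suc[i] _) , ≤-trans (≡⇒≥ e) (i≤suc[i] _)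
≺⇒Near {s} {s′} (inj₂ (e , _)) with ∣i-j∣≡1⇒ (level s) (level s′) e
... | inj₁ d = ≡⇒≤ d , ≤-trans (i≤suc[i] (level s′)) (≤-trans (≡⇒≥ d) (i≤suc[i] (level s)))
... | inj₂ d = ≤-trans (i≤suc[i] (level s)) (≤-trans (≡⇒≥ d) (i≤suc[i] (level s′))) , ≡⇒≤ d

≺⇒≢ : ∀ {s s′} → s ≺ s′ → s ≢ s′
≺⇒≢ (inj₁ (_ , x<x)) refl = <-irrefl refl x<x
≺⇒≢ {s} (inj₂ (e , _)) refl with () ← trans (sym e) (cong ∣_∣ (+-inverseʳ (level s)))

≺⇒⋭ : ∀ {s s′} → s ≺ s′ → ¬ (s′ ⊴ s)
≺⇒⋭ s≺s′ s′⊴s = ≺⇒≢ s≺s′ (⊴-antisym (≺⇒⊴ s≺s′) s′⊴s)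

⊴⇒≺ : ∀ {s s′} → Near s s′ → s ≢ s′ → s ⊴ s′ → s ≺ s′
⊴⇒≺ {s@(x , y)} {s′@(x′ , y′)} (lo , hi) s≢s′ (p , q) with <-cmp (level s) (level s′)
... | tri< l<l′ _ _ = inj₂ (cong ∣_∣ (j≡1+i⇒ {level s} (≤-antisym hi (below l<l′))) , p , q)
... | tri> _ _ l>l′ = inj₂ (cong ∣_∣ (i≡1+j⇒ {j = level s′} (≤-antisym lo (below l>l′))) , p , q)
... | tri≈ _ l≡l′ _ = inj₁ (l≡l′ , ≤∧≢⇒< p λ { refl → s≢s′ (cong (x ,_) (+-cancelˡ-≡ x l≡l′)) })

-- Incomparable squares differ strictly and in the same direction in both coordinates, so their
-- levels differ by at least two.
⊴-total : ∀ {s s′} → Near s s′ → (s ⊴ s′) ⊎ (s′ ⊴ s)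
⊴-total {x , y} {x′ , y′} (lo , hi) with x ≤? x′ | y′ ≤? y
... | yes p | yes q = inj₁ (p , q)
... | yes p | no  q = inj₂ (i+j≤1+k+m⇒i≤k hi (≰⇒> q) , <⇒≤ (≰⇒> q))
... | no  p | _     = inj₂ (<⇒≤ (≰⇒> p) , i+j≤1+k+m⇒j≤m lo (≰⇒> p))

≺-total : ∀ {s s′} → Near s s′ → s ≢ s′ → (s ≺ s′) ⊎ (s′ ≺ s)
≺-total near@(lo , hi) s≢s′ with ⊴-total near
... | inj₁ p = inj₁ (⊴⇒≺ near s≢s′ p)
... | inj₂ p = inj₂ (⊴⇒≺ (hi , lo) (λ e → s≢s′ (sym e)) p)

-- A discrete intermediate value theorem: each step changes the level by one, so the first step to
-- exceed level m starts exactly on it.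
walk-crosses : ∀ {S s s′} → Walk S s s′ → ∀ {m} → level s ≤ m → m < level s′ →
  ∃₂ λ a b → a ∈ S × b ∈ S × a ↗ b × level a ≡ m
walk-crosses ε s≤m m<s = contradiction (≤-<-trans s≤m m<s) (<-irrefl refl)
walk-crosses {s = s} (_◅_ {j = s₁} (s∈ , s₁∈ , adj) w) {m} s≤m m<s′ with level s₁ ≤? m
... | yes s₁≤m = walk-crosses w s₁≤m m<s′
... | no  s₁≰m with ↗-oriented adj
...   | inj₁ s↗s₁ = s , s₁ , s∈ , s₁∈ , s↗s₁ ,
          ≤-antisym s≤m (i<1+j⇒i≤j (<-≤-trans (≰⇒> s₁≰m) (≡⇒≤ (level-↗ s↗s₁))))
...   | inj₂ s₁↗s = contradiction (≤-trans (≤-trans (i≤suc[i] (level s₁)) (≡⇒≥ (level-↗ s₁↗s))) s≤m) s₁≰m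

offset : ∀ {n c l} → c ≤ l → l < c + + n → ∃[ k ] k ℕ.< n × l ≡ c + + k
offset {n} {c} {l} c≤l l<c+n =
  ∣ l - c ∣ , drop‿+<+ (subst (_< + n) (sym eq) (i<j+k⇒i-j<k l c (+ n) l<c+n)) ,
  trans (sym (i+[j-i]≡j c l)) (cong (ℤ._+_ c) (sym eq))
  where
  eq : + ∣ l - c ∣ ≡ l - c
  eq = 0≤i⇒+∣i∣≡i (i≤j⇒0≤j-i c≤l)

-- From n on, the enumeration at may repeat squares arbitrarily.
record Ribbon (n : ℕ) (c : ℤ) (t : SquareSet) : Set where
  field
    at       : ℕ → Square
    at∈      : ∀ k → at k ∈ t
    level-at : ∀ {k} → k ℕ.< n → level (at k) ≡ c + + k
    at-onto  : ∀ {s} → s ∈ t → ∃[ k ] k ℕ.< n × s ≡ at k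
    step     : ∀ {k} → suc k ℕ.< n → at k ↗ at (suc k)

  in-range : ∀ {s} → s ∈ t → c ≤ level s × level s < c + + n
  in-range s∈ with at-onto s∈
  ... | k , k<n , refl rewrite level-at k<n = i≤i+j c (+ k) , +-monoʳ-< c (+<+ k<n)

  level-injective : ∀ {s s′} → s ∈ t → s′ ∈ t → level s ≡ level s′ → s ≡ s′
  level-injective s∈ s′∈ e with at-onto s∈ | at-onto s′∈
  ... | k , k<n , refl | k′ , k′<n , refl =
    cong at (+-injective (+-cancelˡ-≡ c (trans (sym (level-at k<n)) (trans e (level-at k′<n)))))

  square-at : ∀ {l} → c ≤ l → l < c + + n → ∃[ s ] s ∈ t × level s ≡ l
  square-at c≤l l<c+n with offset c≤l l<c+n
  ... | k , k<n , refl = at k , at∈ k , level-at k<n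

  next : ∀ {s} → s ∈ t → sucℤ (level s) < c + + n → ∃[ s′ ] s′ ∈ t × s ↗ s′
  next s∈ h with at-onto s∈
  ... | k , k<n , refl = at (suc k) , at∈ (suc k) ,
          step (drop‿+<+ (+-cancelˡ-< c (subst (_< c + + n) eq h)))
    where
    eq : sucℤ (level (at k)) ≡ c + + suc k
    eq = trans (cong sucℤ (level-at k<n)) (1+[i+j]≡i+[1+j] c (+ k))
    +-cancelˡ-< : ∀ i {j k} → i + j < i + k → j < k
    +-cancelˡ-< i {j} {k} h = <-from (below h) (solve (i ∷ j ∷ k ∷ []))

  hasLevel : HasLevel c t
  hasLevel with at-onto (at∈ 0)
  ... | _ , k<n , _ = lose (at∈ 0) (trans (level-at (ℕ.≤-<-trans z≤n k<n)) (+-identityʳ c)) ,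
                      All.tabulate λ s∈ → proj₁ (in-range s∈)

ribbon-level : ∀ {n c c′ t} → Ribbon n c t → HasLevel c′ t → c ≡ c′
ribbon-level r (any , all) with find any
... | s , s∈ , refl = ≤-antisym (proj₁ (in-range s∈)) (c′≤c)
  where
  open Ribbon r
  c′≤c : level s ≤ _
  c′≤c with find (proj₁ hasLevel)
  ... | s′ , s′∈ , refl = All.lookup all s′∈

lowest : ∀ {t s} → s ∈ t → ∃[ s₀ ] s₀ ∈ t × (∀ {s} → s ∈ t → level s₀ ≤ level s)
lowest {t} {s} s∈ = argmin level s t , member (argmin-sel level s t) ,
  λ s′∈ → All.lookup (f[argmin]≤f[xs] s t) s′∈
  where
  member : (argmin level s t ≡ s) ⊎ (argmin level s t ∈ t) → argmin level s t ∈ t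
  member (inj₁ e) = subst (_∈ t) (sym e) s∈
  member (inj₂ p) = p

-- If the tile reached level c + n, connectedness would give it a square on exactly that level, with
-- the color of s₀ but different from s₀. So its levels lie in a window of n values, in which the
-- color determines the level.
ribbon-above : ∀ {n} .{{_ : NonZero n}} {t s₀} → RibbonTile n t → s₀ ∈ t →
  (∀ {s} → s ∈ t → level s₀ ≤ level s) → Ribbon n (level s₀) t
ribbon-above {n} {t} {s₀} tile s₀∈ c≤ = record
  { at       = at
  ; at∈      = at∈
  ; level-at = level-at
  ; at-onto  = λ {s} s∈ → at-onto s∈
  ; step     = step
  }
  where
  open RibbonTile tile
  0<n : 0 ℕ.< n
  0<n = ℕ.>-nonZero⁻¹ n
  same-color : ∀ {s s′} → s ∈ t → s′ ∈ t → color n s ≡ color n s′ → s ≡ s′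
  same-color {s} {s′} s∈ s′∈ e with colors (color n s) (n%ℕd<d (level s) n)
  ... | _ , _ , uniq = trans (sym (uniq (s∈ , refl))) (uniq (s′∈ , sym e))
  c : ℤ
  c = level s₀
  <c+n : ∀ {s} → s ∈ t → level s < c + + n
  <c+n {s} s∈ = ≰⇒> λ c+n≤s → crosses-top (walk-crosses (connected s₀∈ s∈) {c + + n - 1ℤ}
    (i<j⇒i≤j-1 (i<i+n n c)) (suc[i]≤j⇒i<j (≤-trans (≡⇒≤ top) c+n≤s)))
    where
    top : 1ℤ + (c + + n - 1ℤ) ≡ c + + n
    top = i+[j-i]≡j 1ℤ (c + + n)
    crosses-top : ¬ (∃₂ λ a b → a ∈ t × b ∈ t × a ↗ b × level a ≡ c + + n - 1ℤ)
    crosses-top (a , b , a∈ , b∈ , a↗b , la) = <⇒≢ (i<i+n n c) (trans (cong level s₀≡b) lb)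
      where
      lb : level b ≡ c + + n
      lb = trans (level-↗ a↗b) (trans (cong sucℤ la) top)
      s₀≡b : s₀ ≡ b
      s₀≡b = same-color s₀∈ b∈ (trans (sym (%-periodic n c)) (cong (_%ℕ n) (sym lb)))
  at : ℕ → Square
  at k = proj₁ (colors ((c + + k) %ℕ n) (n%ℕd<d (c + + k) n))
  at∈ : ∀ k → at k ∈ t
  at∈ k = proj₁ (proj₁ (proj₂ (colors ((c + + k) %ℕ n) (n%ℕd<d (c + + k) n))))
  color-at : ∀ k → color n (at k) ≡ (c + + k) %ℕ n
  color-at k = proj₂ (proj₁ (proj₂ (colors ((c + + k) %ℕ n) (n%ℕd<d (c + + k) n))))
  close : ∀ {i j} → c ≤ i → j < c + + n → j < i + + n
  close c≤i j<c+n = <-≤-trans j<c+n (+-monoˡ-≤ (+ n) c≤i)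
  level-at : ∀ {k} → k ℕ.< n → level (at k) ≡ c + + k
  level-at {k} k<n = %-injective n (color-at k)
    (close (i≤i+j c (+ k)) (<c+n (at∈ k))) (close (c≤ (at∈ k)) (+-monoʳ-< c (+<+ k<n)))
  level⇒≡ : ∀ {s k} → s ∈ t → level s ≡ c + + k → s ≡ at k
  level⇒≡ {k = k} s∈ e = same-color s∈ (at∈ k) (trans (cong (_%ℕ n) e) (sym (color-at k)))
  at-onto : ∀ {s} → s ∈ t → ∃[ k ] k ℕ.< n × s ≡ at k
  at-onto s∈ = let k , k<n , e = offset (c≤ s∈) (<c+n s∈) in k , k<n , level⇒≡ s∈ e
  step : ∀ {k} → suc k ℕ.< n → at k ↗ at (suc k)
  -- A walk inside the tile has to pass from level c + k to the next level; as each level holds one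
  -- square of the tile, the crossing step joins the two given squares.
  step {k} k+1<n = edge (walk-crosses (connected (at∈ k) (at∈ (suc k))) {c + + k} (≡⇒≤ (level-at k<n))
                        (subst (c + + k <_) (sym (level-at k+1<n)) (+-monoʳ-< c (+<+ (ℕ.n<1+n k)))))
    where
    k<n : k ℕ.< n
    k<n = ℕ.<-trans (ℕ.n<1+n k) k+1<n
    edge : (∃₂ λ a b → a ∈ t × b ∈ t × a ↗ b × level a ≡ c + + k) → at k ↗ at (suc k)
    edge (a , b , a∈ , b∈ , a↗b , la) = subst₂ _↗_ (level⇒≡ a∈ la)
      (level⇒≡ b∈ (trans (level-↗ a↗b) (trans (cong sucℤ la) (1+[i+j]≡i+[1+j] c (+ k))))) a↗b

ribbon : ∀ {n} .{{_ : NonZero n}} {t} → RibbonTile n t → ∃[ c ] Ribbon n c t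
ribbon {n} tile with RibbonTile.colors tile 0 (ℕ.>-nonZero⁻¹ n)
... | s , (s∈ , _) , _ with lowest s∈
...   | s₀ , s₀∈ , c≤ = level s₀ , ribbon-above tile s₀∈ c≤

-- Sums over finite sets of squares

private
  variable
    A P Q : Set

Sum : (A → ℤ) → List A → ℤ
Sum w = foldr (λ x z → w x + z) 0ℤ

Sum-cong : ∀ {v w : A → ℤ} {xs} → (∀ {x} → x ∈ xs → v x ≡ w x) → Sum v xs ≡ Sum w xs
Sum-cong {xs = []}     eq = refl
Sum-cong {xs = x ∷ xs} eq = cong₂ _+_ (eq (here refl)) (Sum-cong (λ x∈ → eq (there x∈)))

Sum-++ : ∀ (w : A → ℤ) xs ys → Sum w (xs ++ ys) ≡ Sum w xs + Sum w ys
Sum-++ w []       ys = sym (+-identityˡ _)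
Sum-++ w (x ∷ xs) ys = trans (cong (ℤ._+_ (w x)) (Sum-++ w xs ys)) (sym (+-assoc (w x) _ _))

Sum-concat : ∀ (w : A → ℤ) xss → Sum w (concat xss) ≡ Sum (Sum w) xss
Sum-concat w []         = refl
Sum-concat w (xs ∷ xss) = trans (Sum-++ w xs (concat xss)) (cong (ℤ._+_ (Sum w xs)) (Sum-concat w xss))

Sum-map : ∀ {B : Set} (w : A → ℤ) (f : B → A) xs → Sum w (map f xs) ≡ Sum (λ x → w (f x)) xs
Sum-map w f []       = refl
Sum-map w f (x ∷ xs) = cong (ℤ._+_ (w (f x))) (Sum-map w f xs)

Sum-minus : ∀ (v w : A → ℤ) xs → Sum (λ x → v x - w x) xs ≡ Sum v xs - Sum w xs
Sum-minus v w []       = refl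
Sum-minus v w (x ∷ xs) = trans (cong (ℤ._+_ (v x - w x)) (Sum-minus v w xs)) (regroup (v x) (w x) _ _)
  where
  regroup : ∀ i j k l → i - j + (k - l) ≡ i + k - (j + l)
  regroup i j k l = solve (i ∷ j ∷ k ∷ l ∷ [])

Sum-zero : ∀ {w : A → ℤ} {xs} → (∀ {x} → x ∈ xs → w x ≡ 0ℤ) → Sum w xs ≡ 0ℤ
Sum-zero {xs = []}     eq = refl
Sum-zero {xs = x ∷ xs} eq = cong₂ _+_ (eq (here refl)) (Sum-zero (λ x∈ → eq (there x∈)))

Sum-↭ : ∀ (w : A → ℤ) {xs ys} → xs ↭ ys → Sum w xs ≡ Sum w ys
Sum-↭ w ↭.refl            = refl
Sum-↭ w (↭.prep x xs↭ys)  = cong (ℤ._+_ (w x)) (Sum-↭ w xs↭ys)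
Sum-↭ w (↭.swap x y xs↭ys) = trans (cong (λ z → w x + (w y + z)) (Sum-↭ w xs↭ys)) (exchange (w x) (w y) _)
  where
  exchange : ∀ i j k → i + (j + k) ≡ j + (i + k)
  exchange i j k = solve (i ∷ j ∷ k ∷ [])
Sum-↭ w (↭.trans p q)     = trans (Sum-↭ w p) (Sum-↭ w q)

-- The outgoing part v⁺ of each entry cancels the incoming part v⁻ of the next one.
telescope : ∀ (f : ℕ → A) (v⁺ v⁻ : A → ℤ) n .{{_ : NonZero n}} →
  (∀ {k} → suc k ℕ.< n → v⁺ (f k) ≡ v⁻ (f (suc k))) →
  Sum (λ x → v⁺ x - v⁻ x) (applyUpTo f n) ≡ v⁺ (f (ℕ.pred n)) - v⁻ (f 0)
telescope f v⁺ v⁻ (suc zero)    link = +-identityʳ _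
telescope f v⁺ v⁻ (suc (suc n)) link = trans
  (cong₂ (λ i j → i - v⁻ (f 0) + j) (link (s≤s (s≤s z≤n)))
    (telescope (λ k → f (suc k)) v⁺ v⁻ (suc n) (λ k<n → link (s≤s k<n))))
  (cancel (v⁻ (f 1)) (v⁻ (f 0)) (v⁺ (f (suc n))))
  where
  cancel : ∀ i j k → i - j + (k - i) ≡ k - j
  cancel i j k = solve (i ∷ j ∷ k ∷ [])

ind : Dec P → ℤ
ind P? = if ⌊ P? ⌋ then 1ℤ else 0ℤ

ind-yes : (P? : Dec P) → P → ind P? ≡ 1ℤ
ind-yes (yes _) _ = refl
ind-yes (no ¬p) p = contradiction p ¬p

ind-no : (P? : Dec P) → ¬ P → ind P? ≡ 0ℤ
ind-no (yes p) ¬p = contradiction p ¬p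
ind-no (no _)  _  = refl

ind-cong : (P? : Dec P) (Q? : Dec Q) → (P → Q) → (Q → P) → ind P? ≡ ind Q?
ind-cong (yes p) Q? to from = sym (ind-yes Q? (to p))
ind-cong (no ¬p) Q? to from = sym (ind-no Q? (λ q → ¬p (from q)))

Sum-ind-unique : ∀ {P : A → Set} (P? : Decidable P) {xs} → Unique xs →
  (∀ {x y} → x ∈ xs → y ∈ xs → P x → P y → x ≡ y) → Sum (λ x → ind (P? x)) xs ≡ ind (any? P? xs)
Sum-ind-unique P? AllPairs.[]      inj = refl
Sum-ind-unique {P = P} P? {x ∷ xs} (x∉xs AllPairs.∷ xs!) inj with P? x
... | no ¬px = trans (+-identityˡ _) (trans (Sum-ind-unique P? xs! (λ x∈ y∈ → inj (there x∈) (there y∈)))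
                 (ind-cong (any? P? xs) _ there (Any.tail ¬px)))
... | yes px = cong (ℤ._+_ 1ℤ) (Sum-zero λ {y} y∈ → ind-no (P? y) λ py →
                 All.lookup x∉xs y∈ (inj (here refl) (there y∈) px py))

_≟ˢ_ : DecidableEquality Square
_≟ˢ_ = ≡-dec _≟_ _≟_

open import Data.List.Membership.DecPropositional _≟ˢ_ using (_∈?_)
open import Data.List.Relation.Unary.Unique.DecPropositional.Properties _≟ˢ_ using (deduplicate-!)

-- Lists stand for sets up to multiplicity, so repetitions have to be removed before summing.
∑ : (Square → ℤ) → SquareSet → ℤ
∑ w S = Sum w (deduplicate _≟ˢ_ S)

-- Two lists without repetitions and with the same members are permutations of each other.
∑-enumeration : ∀ w {S xs} → Unique xs → (∀ {s} → s ∈ S → s ∈ xs) → (∀ {s} → s ∈ xs → s ∈ S) →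
  ∑ w S ≡ Sum w xs
∑-enumeration w {S} xs! to from = Sum-↭ w (∼bag⇒↭ (unique∧set⇒bag (deduplicate-! S) xs!
  (mk⇔ (λ s∈ → to (∈-deduplicate⁻ _≟ˢ_ S s∈)) (λ s∈ → ∈-deduplicate⁺ _≟ˢ_ (from s∈)))))

∑-ind : ∀ {P : Square → Set} (P? : Decidable P) {S} →
  (∀ {s s′} → s ∈ S → s′ ∈ S → P s → P s′ → s ≡ s′) → ∑ (λ s → ind (P? s)) S ≡ ind (any? P? S)
∑-ind P? {S} inj = trans
  (Sum-ind-unique P? (deduplicate-! S) λ s∈ s′∈ →
    inj (∈-deduplicate⁻ _≟ˢ_ S s∈) (∈-deduplicate⁻ _≟ˢ_ S s′∈))
  (ind-cong (any? P? _) (any? P? S)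
    (λ q → let s , s∈ , ps = find q in lose (∈-deduplicate⁻ _≟ˢ_ S s∈) ps)
    (λ q → let s , s∈ , ps = find q in lose (∈-deduplicate⁺ _≟ˢ_ s∈) ps))

∑-cong : ∀ {v w S} → (∀ {s} → s ∈ S → v s ≡ w s) → ∑ v S ≡ ∑ w S
∑-cong {S = S} eq = Sum-cong λ s∈ → eq (∈-deduplicate⁻ _≟ˢ_ S s∈)

module Tiling {n} .{{_ : NonZero n}} {R α} (tiling : RibbonTiling n R α) where
  open RibbonTiling tiling

  tile⇒ribbon : ∀ {t} → t ∈ α → ∃[ c ] Ribbon n c t
  tile⇒ribbon t∈ = ribbon (All.lookup ribbons t∈)

  tile⊆R : ∀ {t s} → t ∈ α → s ∈ t → s ∈ R
  tile⊆R {s = s} t∈ s∈ = Equivalence.from (covers s) (lose t∈ s∈)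

  same-tile : ∀ {t u s} → t ∈ α → u ∈ α → s ∈ t → s ∈ u → t ≡ u
  same-tile = go disjoint
    where
    open AllPairs.AllPairs using (_∷_)
    go : ∀ {xs t u s} → AllPairs Disjoint xs → t ∈ xs → u ∈ xs → s ∈ t → s ∈ u → t ≡ u
    go _          (here refl) (here refl) _  _   = refl
    go (d ∷ _)    (here refl) (there u∈)  s∈ s∈′ = contradiction (s∈ , s∈′) (All.lookup d u∈)
    go (d ∷ _)    (there t∈)  (here refl) s∈ s∈′ = contradiction (s∈′ , s∈) (All.lookup d t∈)
    go (_ ∷ ds)   (there t∈)  (there u∈)  s∈ s∈′ = go ds t∈ u∈ s∈ s∈′

  -- As the tiles are disjoint, the concatenation of the tiles without their repetitions enumerates
  -- R without repetition.
  ∑-tiling : ∀ w → ∑ w R ≡ Sum (∑ w) α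
  ∑-tiling w = trans
    (∑-enumeration w
      (Unique.concat⁺ (Allₚ.map⁺ (All.universal deduplicate-! α))
        (AllPairsₚ.map⁺ (AllPairs.map disjoint-dedup disjoint)))
      (λ s∈ → let t , t∈ , s∈t = find (Equivalence.to (covers _) s∈) in
        ∈-concat⁺′ (∈-deduplicate⁺ _≟ˢ_ s∈t) (∈-map⁺ _ t∈))
      from)
    (trans (Sum-concat w (map (deduplicate _≟ˢ_) α)) (Sum-map (Sum w) (deduplicate _≟ˢ_) α))
    where
    disjoint-dedup : ∀ {t u} → Disjoint t u → Disjoint (deduplicate _≟ˢ_ t) (deduplicate _≟ˢ_ u)
    disjoint-dedup {t} {u} d (s∈ , s∈′) = d (∈-deduplicate⁻ _≟ˢ_ t s∈ , ∈-deduplicate⁻ _≟ˢ_ u s∈′)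
    from : ∀ {s} → s ∈ concat (map (deduplicate _≟ˢ_) α) → s ∈ R
    from s∈ with ∈-concat⁻′ (map (deduplicate _≟ˢ_) α) s∈
    ... | _ , s∈d , d∈ with ∈-map⁻ (deduplicate _≟ˢ_) d∈
    ...   | t , t∈ , refl = tile⊆R t∈ (∈-deduplicate⁻ _≟ˢ_ t s∈d)

∑-ribbon : ∀ {n c t} w (r : Ribbon n c t) → ∑ w t ≡ Sum w (applyUpTo (Ribbon.at r) n)
∑-ribbon {n} {c} {t} w r = ∑-enumeration w
  (Unique.applyUpTo⁺₁ at n λ i<j j<n e → <⇒≢ (+-monoʳ-< c (+<+ i<j))
    (trans (sym (level-at (ℕ.<-trans i<j j<n))) (trans (cong level e) (level-at j<n))))
  (λ s∈ → let k , k<n , e = at-onto s∈ in subst (_∈ applyUpTo at n) (sym e) (∈-applyUpTo⁺ at k<n))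
  (λ s∈ → let k , _ , e = ∈-applyUpTo⁻ at s∈ in subst (_∈ t) (sym e) (at∈ k))
  where open Ribbon r

telescope-ribbon : ∀ {n c t} .{{_ : NonZero n}} (r : Ribbon n c t) (v⁺ v⁻ : Square → ℤ) →
  (∀ {s s′} → s ∈ t → s′ ∈ t → s ↗ s′ → v⁺ s ≡ v⁻ s′) →
  ∑ (λ s → v⁺ s - v⁻ s) t ≡ v⁺ (Ribbon.at r (ℕ.pred n)) - v⁻ (Ribbon.at r 0)
telescope-ribbon {n} r v⁺ v⁻ link = trans (∑-ribbon (λ s → v⁺ s - v⁻ s) r)
  (telescope at v⁺ v⁻ n (λ {k} k<n → link (at∈ k) (at∈ (suc k)) (step k<n)))
  where open Ribbon r

-- Invariant counts of tiles

Meets : ℤ → (Square → Set) → SquareSet → Set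
Meets l Q t = Any (λ s → level s ≡ l × Q s) t

at-level? : ∀ l {Q : Square → Set} → Decidable Q → Decidable (λ s → level s ≡ l × Q s)
at-level? l Q? s = (level s ≟ l) ×-dec Q? s

meets? : ∀ l {Q : Square → Set} → Decidable Q → Decidable (Meets l Q)
meets? l Q? t = any? (at-level? l Q?) t

∑-meets : ∀ {n c t} → Ribbon n c t → ∀ l {Q : Square → Set} (Q? : Decidable Q) →
  ∑ (λ s → ind (at-level? l Q? s)) t ≡ ind (meets? l Q? t)
∑-meets r l Q? = ∑-ind (at-level? l Q?) λ s∈ s′∈ (e , _) (e′ , _) →
  Ribbon.level-injective r s∈ s′∈ (trans e (sym e′))

meets-at : ∀ {n c t l s} {Q : Square → Set} → Ribbon n c t → s ∈ t → level s ≡ l → Meets l Q t → Q s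
meets-at {Q = Q} r s∈ e m with find m
... | z , z∈ , ez , qz = subst Q (Ribbon.level-injective r z∈ s∈ (trans ez (sym e))) qz

count : ∀ {P : SquareSet → Set} → Decidable P → ℤ → List SquareSet → ℕ
count P? c α = length (filter P? (tilesOfLevel c α))

length-filter² : ∀ {P Q : A → Set} (P? : Decidable P) (Q? : Decidable Q) xs →
  + length (filter P? (filter Q? xs)) ≡ Sum (λ x → ind (Q? x ×-dec P? x)) xs
length-filter² P? Q? []       = refl
length-filter² P? Q? (x ∷ xs) with Q? x
... | no _  = trans (length-filter² P? Q? xs) (sym (+-identityˡ _))
... | yes _ with P? x
...   | yes _ = cong (ℤ._+_ 1ℤ) (length-filter² P? Q? xs)
...   | no _  = trans (length-filter² P? Q? xs) (sym (+-identityˡ _))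

count≡Sum : ∀ {P : SquareSet → Set} (P? : Decidable P) c α →
  + count P? c α ≡ Sum (λ t → ind (hasLevel? c t ×-dec P? t)) α
count≡Sum P? c α = length-filter² P? (hasLevel? c) α

-- φ jumps exactly where a step leaves, upwards or rightwards, a square of the
-- cut formed by the squares of level l with Q.
record Primitive (R : SquareSet) (l : ℤ) {Q : Square → Set} (Q? : Decidable Q) : Set where
  field
    φ    : Square → ℤ
    step : ∀ {s s′} → s ∈ R → s′ ∈ R → s ↗ s′ → φ s′ ≡ φ s + ind (at-level? l Q? s)

module _ {n} .{{_ : NonZero n}} {R c l} {Q : Square → Set} {Q? : Decidable Q}
         (prim : Primitive R l Q?) (c≤l : c ≤ l) (l<c+n : l < c + + n) where
  open Primitive prim

  private
    γ : ℤ → ℤ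
    γ k = ind (k %ℕ n ℕ.≟ c %ℕ n)

    δ : Square → ℤ
    δ s = ind (at-level? l Q? s)

  -- Two consecutive squares of a tile have cancelling terms, and γ agrees at the
  -- two ends of the tile because n divides the difference of the levels there.
  weight : Square → ℤ
  weight s = γ (sucℤ (level s)) * (φ s + δ s) - γ (level s) * φ s

  ∑-weight : ∀ {c′ t} → Ribbon n c′ t → (∀ {s} → s ∈ t → s ∈ R) →
    ∑ weight t ≡ γ c′ * ind (meets? l Q? t)
  ∑-weight {c′} {t} r t⊆R = begin
    ∑ weight t
      ≡⟨ telescope-ribbon r (λ s → γ (sucℤ (level s)) * (φ s + δ s)) (λ s → γ (level s) * φ s)
           (λ s∈ s′∈ s↗s′ → cong₂ _*_ (cong γ (sym (level-↗ s↗s′)))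
                                      (sym (Primitive.step prim (t⊆R s∈) (t⊆R s′∈) s↗s′))) ⟩
    γ (sucℤ (level z)) * (φ z + δ z) - γ (level (at 0)) * φ (at 0)
      ≡⟨ cong₂ (λ i j → i * (φ z + δ z) - j * φ (at 0)) γ-last γ-first ⟩
    γ c′ * (φ z + δ z) - γ c′ * φ (at 0)
      ≡⟨ factor (γ c′) (φ z + δ z) (φ (at 0)) ⟩
    γ c′ * (φ z + δ z - φ (at 0))
      -- A second telescoping, now without γ, turns the total increase of φ along the tile into the
      -- sum of its increments δ.
      ≡⟨ cong (γ c′ *_) (telescope-ribbon r (λ s → φ s + δ s) φ
           (λ s∈ s′∈ s↗s′ → sym (Primitive.step prim (t⊆R s∈) (t⊆R s′∈) s↗s′))) ⟨
    γ c′ * ∑ (λ s → φ s + δ s - φ s) t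
      ≡⟨ cong (γ c′ *_) (∑-cong {S = t} (λ {s} _ → drop (φ s) (δ s))) ⟩
    γ c′ * ∑ δ t
      ≡⟨ cong (γ c′ *_) (∑-meets r l Q?) ⟩
    γ c′ * ind (meets? l Q? t) ∎
    where
    open ≡-Reasoning
    open Ribbon r using (at; level-at)
    z : Square
    z = at (ℕ.pred n)
    0<n : 0 ℕ.< n
    0<n = ℕ.>-nonZero⁻¹ n
    factor : ∀ i j k → i * j - i * k ≡ i * (j - k)
    factor i j k = solve (i ∷ j ∷ k ∷ [])
    drop : ∀ i j → i + j - i ≡ j
    drop i j = solve (i ∷ j ∷ [])
    γ-first : γ (level (at 0)) ≡ γ c′
    γ-first = cong γ (trans (level-at 0<n) (+-identityʳ c′))
    γ-last : γ (sucℤ (level z)) ≡ γ c′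
    γ-last = trans
      (cong γ (trans (cong sucℤ (level-at (ℕ.≤-reflexive (ℕ.suc-pred n))))
                     (trans (1+[i+j]≡i+[1+j] c′ (+ ℕ.pred n)) (cong (λ m → c′ + + m) (ℕ.suc-pred n)))))
      (cong (λ r → ind (r ℕ.≟ c %ℕ n)) (%-periodic n c′))

  -- A tile that meets level l has its own level less than n away from c, so the congruence tested
  -- by γ becomes equality of levels.
  level-weight : ∀ {c′ t} → Ribbon n c′ t →
    γ c′ * ind (meets? l Q? t) ≡ ind (hasLevel? c t ×-dec meets? l Q? t)
  level-weight {c′} {t} r with meets? l Q? t
  ... | no ¬m = trans (*-zeroʳ (γ c′)) (sym (ind-no (hasLevel? c t ×-dec no ¬m) λ (_ , m) → ¬m m))
  ... | yes m = trans (*-identityʳ (γ c′)) (ind-cong (c′ %ℕ n ℕ.≟ c %ℕ n) (hasLevel? c t ×-dec yes m)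
          (λ e → subst (λ k → HasLevel k t) (c′≡c e) hasLevel , m)
          (λ (h , _) → cong (_%ℕ n) (ribbon-level r h)))
    where
    open Ribbon r
    c′≡c : c′ %ℕ n ≡ c %ℕ n → c′ ≡ c
    c′≡c e = let s , s∈ , ls , _ = find m ; lo , hi = in-range s∈ in
      %-injective n e (≤-<-trans (≤-trans lo (≡⇒≤ ls)) l<c+n)
                      (≤-<-trans (≤-trans c≤l (≡⇒≥ ls)) hi)

  count-meets : ∀ {α} → RibbonTiling n R α → + count (meets? l Q?) c α ≡ ∑ weight R
  count-meets {α} tiling = begin
    + count (meets? l Q?) c α                               ≡⟨ count≡Sum (meets? l Q?) c α ⟩
    Sum (λ t → ind (hasLevel? c t ×-dec meets? l Q? t)) α    ≡⟨ Sum-cong tile-weight ⟨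
    Sum (∑ weight) α                                        ≡⟨ ∑-tiling weight ⟨
    ∑ weight R                                              ∎
    where
    open ≡-Reasoning
    open Tiling tiling
    tile-weight : ∀ {t} → t ∈ α → ∑ weight t ≡ ind (hasLevel? c t ×-dec meets? l Q? t)
    tile-weight t∈ = let _ , r = tile⇒ribbon t∈ in trans (∑-weight r (tile⊆R t∈)) (level-weight r)

  count-invariant : ∀ {α β} → RibbonTiling n R α → RibbonTiling n R β →
    count (meets? l Q?) c α ≡ count (meets? l Q?) c β
  count-invariant tα tβ = +-injective (trans (count-meets tα) (sym (count-meets tβ)))

-- Describes how the indicator of the levels above l grows on a step from level i: the step ends on
-- level i + 1, which is above l exactly when l ≤ i.
split-ind : ∀ {P : Set} (P? : Dec P) i l →
  ind (P? ×-dec (l <? i)) + ind ((i ≟ l) ×-dec P?) ≡ ind (P? ×-dec (l ≤? i))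
split-ind P? i l with P?
... | no ¬p = cong (ℤ._+_ 0ℤ) (ind-no ((i ≟ l) ×-dec no ¬p) λ (_ , p) → ¬p p)
... | yes p with <-cmp l i
...   | tri< l<i l≢i _ = trans (cong₂ _+_ (ind-yes (yes p ×-dec (l <? i)) (p , l<i))
                                          (ind-no ((i ≟ l) ×-dec yes p) λ (e , _) → l≢i (sym e)))
                               (sym (ind-yes (yes p ×-dec (l ≤? i)) (p , <⇒≤ l<i)))
...   | tri≈ l≮i l≡i _ = trans (cong₂ _+_ (ind-no (yes p ×-dec (l <? i)) λ (_ , l<i) → l≮i l<i)
                                          (ind-yes ((i ≟ l) ×-dec yes p) (sym l≡i , p)))
                               (sym (ind-yes (yes p ×-dec (l ≤? i)) (p , ≡⇒≤ l≡i)))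
...   | tri> _ l≢i i<l = trans (cong₂ _+_ (ind-no (yes p ×-dec (l <? i)) λ (_ , l<i) → <-asym l<i i<l)
                                          (ind-no ((i ≟ l) ×-dec yes p) λ (e , _) → l≢i (sym e)))
                               (sym (ind-no (yes p ×-dec (l ≤? i)) λ (_ , l≤i) → <⇒≱ i<l l≤i))

≤⇔<suc : ∀ {i j l} → j ≡ sucℤ i → (l ≤ i → l < j) × (l < j → l ≤ i)
≤⇔<suc refl = i≤j⇒i<1+j , i<1+j⇒i≤j

everywhere : ∀ R l → Primitive R l (λ _ → yes tt)
everywhere R l = record
  { φ    = λ s → ind (yes tt ×-dec (l <? level s))
  ; step = λ {s} {s′} _ _ s↗s′ → let to , from = ≤⇔<suc (level-↗ s↗s′) in trans
      (ind-cong (yes tt ×-dec (l <? level s′)) (yes tt ×-dec (l ≤? level s))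
        (λ (t , h) → t , from h) (λ (t , h) → t , to h))
      (sym (split-ind (yes tt) (level s) l))
  }

southEast? : ∀ p → Decidable (p ⊴_)
southEast? (a , b) (x , y) = (a ≤? x) ×-dec (y ≤? b)

-- Winding numbers as potentials

winding-◅◅ : ∀ p {S s s′ s″} (w : Walk S s s′) (w′ : Walk S s′ s″) →
  winding p (w ◅◅ w′) ≡ winding p w + winding p w′
winding-◅◅ p ε                 w′ = sym (+-identityˡ _)
winding-◅◅ p ((_ , _ , a) ◅ w) w′ =
  trans (cong (ℤ._+_ (crossing p a)) (winding-◅◅ p w w′)) (sym (+-assoc (crossing p a) _ _))

module _ {R} (region : SimplyConnectedRegion R) {p} (p∉R : p ∉ R) {s₀} (s₀∈R : s₀ ∈ R) where
  open SimplyConnectedRegion region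

  potential-from : ∀ {s} → Dec (s ∈ R) → ℤ
  potential-from (yes s∈) = winding p (connected s₀∈R s∈)
  -- A default value: `Primitive` constrains φ on R only.
  potential-from (no _)   = 0ℤ

  potential : Square → ℤ
  potential s = potential-from (s ∈? R)

  -- Closing both walks by the same way back gives closed walks in R, and these do not wind around
  -- p.
  winding-unique : ∀ {s} → s ∈ R → (w w′ : Walk R s₀ s) → winding p w ≡ winding p w′
  winding-unique s∈ w w′ = cancel (winding p w) (winding p w′) (winding p back) (closed w) (closed w′)
    where
    back : Walk R _ s₀
    back = connected s∈ s₀∈R
    closed : ∀ w → winding p w + winding p back ≡ 0ℤ
    closed w = trans (sym (winding-◅◅ p w back)) (noHoles p∉R (w ◅◅ back))
    cancel : ∀ i j k → i + k ≡ 0ℤ → j + k ≡ 0ℤ → i ≡ j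
    cancel i j k e e′ = ≤-antisym (≤-from (≡⇒≤ e ⊕ ≡⇒≥ e′) (solve (i ∷ j ∷ k ∷ [])))
                                  (≤-from (≡⇒≥ e ⊕ ≡⇒≤ e′) (solve (i ∷ j ∷ k ∷ [])))

  potential≡winding : ∀ {s} → s ∈ R → (w : Walk R s₀ s) → potential s ≡ winding p w
  potential≡winding {s} s∈ w with s ∈? R
  ... | yes s∈′ = winding-unique s∈ (connected s₀∈R s∈′) w
  ... | no s∉   = contradiction s∈ s∉

  potential-step : ∀ {s s′} → s ∈ R → s′ ∈ R → (adj : Adjacent s s′) →
    potential s′ ≡ potential s + crossing p adj
  potential-step {s} s∈ s′∈ adj = trans (potential≡winding s′∈ (w ◅◅ edge))
    (trans (winding-◅◅ p w edge)
           (cong₂ _+_ (sym (potential≡winding s∈ w)) (+-identityʳ (crossing p adj))))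
    where
    w : Walk R s₀ s
    w = connected s₀∈R s∈
    edge : Walk R s _
    edge = (s∈ , s′∈ , adj) ◅ ε

  -- As l is within one of the level of p, the ray and the cut both begin next to p. A step at which
  -- `φ` jumped wrongly would have to start or end in p, which is outside R.
  southEast : ∀ {l} → level p ≤ sucℤ l → l ≤ sucℤ (level p) → Primitive R l (southEast? p)
  southEast {l} lp≤ l≤ = record { φ = φ ; step = step }
    where
    -- The potential jumps across the horizontal ray of crossing; W is the
    -- indicator of the region between that ray and the cut of level l.
    W : Square → ℤ
    W s = ind (southEast? p s ×-dec (l <? level s))
    φ : Square → ℤ
    φ s = potential s + W s
    jump : ∀ {s s′} → s ∈ R → s′ ∈ R → (e : s ↗ s′) →
      crossing p (↗⇒Adjacent e) + W s′ ≡ ind (southEast? p s ×-dec (l ≤? level s))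
    jump {x , y} s∈ s′∈ e@east = trans (+-identityˡ _)
      (ind-cong (southEast? p (sucℤ x , y) ×-dec (l <? level (sucℤ x , y)))
                (southEast? p (x , y) ×-dec (l ≤? level (x , y)))
        (λ ((a≤ , y≤) , h) → (a≤x a≤ y≤ (proj₂ (≤⇔<suc (level-↗ e)) h) , y≤) , proj₂ (≤⇔<suc (level-↗ e)) h)
        (λ ((a≤ , y≤) , h) → (≤-trans a≤ (i≤suc[i] x) , y≤) , proj₁ (≤⇔<suc (level-↗ e)) h))
      where
      a : ℤ
      a = proj₁ p
      b : ℤ
      b = proj₂ p
      a≤x : a ≤ sucℤ x → y ≤ b → l ≤ x + y → a ≤ x
      -- If the east step entered the quadrant through its western side, then x + 1 = a, and the
      -- bounds on the levels would give y = b as well: s′ would be p.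
      a≤x a≤ y≤ h = ≮⇒≥ λ x<a → p∉R (subst (_∈ R)
        (cong₂ _,_ (≤-antisym (below x<a) a≤)
          (≤-antisym y≤ (b≤y a b x y l (below x<a) h lp≤))) s′∈)
        where
        b≤y : ∀ a b x y l → 1ℤ + x ≤ a → l ≤ x + y → a + b ≤ 1ℤ + l → b ≤ y
        b≤y a b x y l h h′ h″ = ≤-from (h ⊕ h′ ⊕ h″) (solve (a ∷ b ∷ x ∷ y ∷ l ∷ []))
    jump {x , y} s∈ s′∈ e@north with y ≟ proj₂ p
    -- From row b the step leaves the quadrant, where `W` vanishes, and the crossing of the ray
    -- supplies the jump. The ray starts strictly east of p; the remaining case x = a is p itself.
    ... | yes refl = trans (cong₂ _+_ (cr (proj₁ p <? x)) W-no) (trans (+-identityʳ _)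
          (ind-cong (proj₁ p <? x) (southEast? p (x , y) ×-dec (l ≤? level (x , y)))
            (λ a<x → (<⇒≤ a<x , ≤-refl) , l≤λ (proj₁ p) x y l (below a<x) l≤)
            (λ ((a≤x , _) , _) → ≤∧≢⇒< a≤x λ { refl → p∉R s∈ })))
      where
      cr : ∀ {P : Set} (P? : Dec P) → (if ⌊ P? ⌋ ∧ true then 1ℤ else 0ℤ) ≡ ind P?
      cr (yes _) = refl
      cr (no _)  = refl
      l≤λ : ∀ a x y l → 1ℤ + a ≤ x → l ≤ 1ℤ + (a + y) → l ≤ x + y
      l≤λ a x y l h h′ = ≤-from (h ⊕ h′) (solve (a ∷ x ∷ y ∷ l ∷ []))
      W-no : W (x , sucℤ y) ≡ 0ℤ
      W-no = ind-no (southEast? p (x , sucℤ y) ×-dec (l <? level (x , sucℤ y)))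
        λ ((_ , h) , _) → <⇒≱ (i≤j⇒i<1+j ≤-refl) h
    ... | no y≢b = trans (cong₂ _+_ (cr (proj₁ p <? x)) refl) (trans (+-identityˡ _)
          (ind-cong (southEast? p (x , sucℤ y) ×-dec (l <? level (x , sucℤ y)))
                    (southEast? p (x , y) ×-dec (l ≤? level (x , y)))
            (λ ((a≤ , y<b) , h) → (a≤ , ≤-trans (i≤suc[i] y) y<b) , proj₂ (≤⇔<suc (level-↗ e)) h)
            (λ ((a≤ , y≤b) , h) → (a≤ , below (≤∧≢⇒< y≤b y≢b)) , proj₁ (≤⇔<suc (level-↗ e)) h)))
      where
      cr : ∀ {P : Set} (P? : Dec P) → (if ⌊ P? ⌋ ∧ false then 1ℤ else 0ℤ) ≡ 0ℤ
      cr (yes _) = refl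
      cr (no _)  = refl
    step : ∀ {s s′} → s ∈ R → s′ ∈ R → s ↗ s′ → φ s′ ≡ φ s + ind (at-level? l (southEast? p) s)
    step {s} {s′} s∈ s′∈ e = begin
      potential s′ + W s′
        ≡⟨ cong (λ i → i + W s′) (potential-step s∈ s′∈ (↗⇒Adjacent e)) ⟩
      potential s + crossing p (↗⇒Adjacent e) + W s′
        ≡⟨ +-assoc (potential s) _ _ ⟩
      potential s + (crossing p (↗⇒Adjacent e) + W s′)
        ≡⟨ cong (ℤ._+_ (potential s)) (trans (jump s∈ s′∈ e)
             (sym (split-ind (southEast? p s) (level s) l))) ⟩
      potential s + (W s + ind (at-level? l (southEast? p) s))
        ≡⟨ +-assoc (potential s) _ _ ⟨
      φ s + ind (at-level? l (southEast? p) s) ∎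
      where open ≡-Reasoning

-- Lists sorted by a relation that need not be transitive

module _ {A : Set} {R : A → A → Set} where
  open All.All using ([]; _∷_)
  open AllPairs.AllPairs using ([]; _∷_)
  open Linked.Linked using ([]; [-]; _∷_)

  linked-map : ∀ {Q : A → Set} {S : A → A → Set} → (∀ {x y} → Q x → Q y → R x y → S x y) →
    ∀ {xs} → All Q xs → Linked R xs → Linked S xs
  linked-map f []            []       = []
  linked-map f (_ ∷ [])      [-]      = [-]
  linked-map f (p ∷ q ∷ qs)  (r ∷ rs) = f p q r ∷ linked-map f (q ∷ qs) rs

  linked-lookup : ∀ {xs} → Linked R xs → ∀ k k′ →
    toℕ k ≡ suc (toℕ k′) → R (lookup xs k′) (lookup xs k)
  linked-lookup (r ∷ _)  (suc zero)    zero     refl = r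
  linked-lookup (_ ∷ rs) (suc k)       (suc k′) e    = linked-lookup rs k k′ (ℕ.suc-injective e)

  private
    Comparable : A → A → Set
    Comparable x y = R x y ⊎ R y x

  linked-insert-after : ∀ {w x ys} → R w x → Linked R (w ∷ ys) → All (Comparable x) ys →
    ∃[ zs ] zs ↭ x ∷ ys × Linked R (w ∷ zs)
  linked-insert-after {x = x} {[]} wx _ _ = x ∷ [] , ↭.refl , wx ∷ [-]
  linked-insert-after {x = x} {y ∷ ys} wx (wy ∷ l) (inj₁ xy ∷ _) = x ∷ y ∷ ys , ↭.refl , wx ∷ xy ∷ l
  linked-insert-after {x = x} {y ∷ ys} wx (wy ∷ l) (inj₂ yx ∷ c) =
    let zs , p , l′ = linked-insert-after yx l c in
    y ∷ zs , ↭.trans (↭.prep y p) (↭.swap y x ↭.refl) , wy ∷ l′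

  linked-insert : ∀ x {ys} → Linked R ys → All (Comparable x) ys → ∃[ zs ] zs ↭ x ∷ ys × Linked R zs
  linked-insert x {[]}     _ _               = x ∷ [] , ↭.refl , [-]
  linked-insert x {y ∷ ys} l (inj₁ xy ∷ _)   = x ∷ y ∷ ys , ↭.refl , xy ∷ l
  linked-insert x {y ∷ ys} l (inj₂ yx ∷ c)   =
    let zs , p , l′ = linked-insert-after yx l c in
    y ∷ zs , ↭.trans (↭.prep y p) (↭.swap y x ↭.refl) , l′

  -- The Hamiltonian path theorem for tournaments: a new element goes before the first entry that it
  -- is found to precede, and the entry before that one precedes it.
  hamiltonian : ∀ {xs} → AllPairs Comparable xs → ∃[ ys ] ys ↭ xs × Linked R ys
  hamiltonian []       = [] , ↭.refl , []
  hamiltonian (c ∷ cs) =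
    let ys , p , l = hamiltonian cs
        zs , q , l′ = linked-insert _ l (All-resp-↭ (↭.↭-sym p) c)
    in zs , ↭.trans q (↭.prep _ p) , l′

module _ {A : Set} {P : A → Set} (P? : Decidable P) where
  open All.All using ([]; _∷_)
  open Linked.Linked using ([]; [-]; _∷_)

  private
    Upward : List A → Set
    Upward = Linked (λ x y → P x → P y)

  upward-all : ∀ {x xs} → Upward (x ∷ xs) → P x → All P (x ∷ xs)
  upward-all [-]      px = px ∷ []
  upward-all (up ∷ l) px = px ∷ upward-all l (up px)

  upward-tail : ∀ {x xs} → Upward (x ∷ xs) → Upward xs
  upward-tail [-]     = []
  upward-tail (_ ∷ l) = l

  -- P holds exactly on a final segment of the list, whose length is that of the filtered list.
  upward-lookup : ∀ {xs} → Upward xs → ∀ k →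
    P (lookup xs k) ⇔ length xs ℕ.≤ toℕ k ℕ.+ length (filter P? xs)
  upward-lookup {x ∷ xs} up k with P? x
  ... | yes px = mk⇔
          (λ _ → ℕ.≤-trans (ℕ.≤-reflexive (cong (λ ys → suc (length ys))
                                                (sym (filter-all P? (All.tail all)))))
                           (ℕ.m≤n+m _ (toℕ k)))
          (λ _ → All.lookup all (∈-lookup k))
    where
    all : All P (x ∷ xs)
    all = upward-all up px
  upward-lookup {x ∷ xs} up zero    | no ¬px = mk⇔ (λ px → contradiction px ¬px)
    (λ h → contradiction (ℕ.≤-trans h (length-filter P? xs)) ℕ.1+n≰n)
  upward-lookup {x ∷ xs} up (suc k) | no ¬px = mk⇔
    (λ p → s≤s (Equivalence.to ih p))
    (λ { (s≤s h) → Equivalence.from ih h })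
    where
    ih : P (lookup xs k) ⇔ length xs ℕ.≤ toℕ k ℕ.+ length (filter P? xs)
    ih = upward-lookup (upward-tail up) k

  upward-first : ∀ {xs} → Upward xs → ∀ k → P (lookup xs k) →
    (∀ k′ → toℕ k ≡ suc (toℕ k′) → ¬ P (lookup xs k′)) →
    toℕ k ℕ.+ length (filter P? xs) ≡ length xs
  upward-first up k pk first = ℕ.≤-antisym (bound up k first) (Equivalence.to (upward-lookup up k) pk)
    where
    bound : ∀ {xs} → Upward xs → ∀ (k : Fin (length xs)) →
      (∀ k′ → toℕ k ≡ suc (toℕ k′) → ¬ P (lookup xs k′)) →
      toℕ k ℕ.+ length (filter P? xs) ℕ.≤ length xs
    bound {x ∷ xs} up zero    first = length-filter P? (x ∷ xs)
    bound {x ∷ xs} up (suc k) first =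
      subst (λ j → j ℕ.+ length (filter P? (x ∷ xs)) ℕ.< length (x ∷ xs)) (toℕ-inject₁ k)
      -- `inject₁ k` is the position just before `suc k`; that it lies outside the final segment
      -- gives the strict bound.
      (ℕ.≰⇒> λ h → first (inject₁ k) (cong suc (sym (toℕ-inject₁ k)))
                         (Equivalence.from (upward-lookup up (inject₁ k)) h))

-- The order of the tiles of one level

-- Comparison on all common levels at once. For disjoint ribbons of one level it agrees with `≺ᵗ`,
-- which asks for a single pair of squares.
LeftOf : SquareSet → SquareSet → Set
LeftOf t u = ∀ s s′ → s ∈ t → s′ ∈ u → level s ≡ level s′ → proj₁ s < proj₁ s′

≡-on-level : ∀ {s s′} → level s ≡ level s′ → proj₁ s ≡ proj₁ s′ → s ≡ s′
≡-on-level {x , y} e refl = cong (x ,_) (+-cancelˡ-≡ x e)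

-- A step changes x by zero or one, so a strict inequality can at worst become an equality, and on a
-- common level this means that the two paths meet. Hence disjoint ribbons do not cross.
↗-mono-< : ∀ {s s₁ s′ s₁′} → s ↗ s₁ → s′ ↗ s₁′ → level s ≡ level s′ → s₁ ≢ s₁′ →
  proj₁ s < proj₁ s′ → proj₁ s₁ < proj₁ s₁′
↗-mono-< east     east     _ _     x<x′ = +-monoʳ-< 1ℤ x<x′
↗-mono-< north    north    _ _     x<x′ = x<x′
↗-mono-< {s′ = x′ , _} north    east     _ _     x<x′ = <-≤-trans x<x′ (i≤suc[i] x′)
↗-mono-< p@east   q@north  e s₁≢s₁′ x<x′ = ≤∧≢⇒< (below x<x′) λ x≡ →
  s₁≢s₁′ (≡-on-level (trans (level-↗ p) (trans (cong sucℤ e) (sym (level-↗ q)))) x≡)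

↗-mono-≤ : ∀ {s s′} → s ↗ s′ → proj₁ s ≤ proj₁ s′ × proj₁ s′ ≤ sucℤ (proj₁ s)
↗-mono-≤ (east {x})  = i≤suc[i] x , ≤-refl
↗-mono-≤ (north {x}) = ≤-refl , i≤suc[i] x

module _ {n} .{{_ : NonZero n}} {c t u} (r : Ribbon n c t) (q : Ribbon n c u) where
  private
    module T = Ribbon r
    module U = Ribbon q
    0<n : 0 ℕ.< n
    0<n = ℕ.>-nonZero⁻¹ n

    same-level : ∀ {k} → k ℕ.< n → level (T.at k) ≡ level (U.at k)
    same-level k<n = trans (T.level-at k<n) (sym (U.level-at k<n))

  bottom-left⇒LeftOf : Disjoint t u → proj₁ (T.at 0) < proj₁ (U.at 0) → LeftOf t u
  bottom-left⇒LeftOf disj bottom _ _ s∈ s′∈ e =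
    let k , k<n , s≡ = T.at-onto s∈ ; k′ , k′<n , s′≡ = U.at-onto s′∈ in
    by-index k k<n k′ k′<n s≡ s′≡ e
    where
    along : ∀ k → k ℕ.< n → proj₁ (T.at k) < proj₁ (U.at k)
    along zero    _   = bottom
    along (suc k) k<n = ↗-mono-< (T.step k<n) (U.step k<n) (same-level k<n′)
      (λ e → disj (T.at∈ (suc k) , subst (_∈ u) (sym e) (U.at∈ (suc k)))) (along k k<n′)
      where
      k<n′ : k ℕ.< n
      k<n′ = ℕ.<-trans (ℕ.n<1+n k) k<n
    by-index : ∀ k → k ℕ.< n → ∀ k′ → k′ ℕ.< n → ∀ {s s′} → s ≡ T.at k → s′ ≡ U.at k′ →
      level s ≡ level s′ → proj₁ s < proj₁ s′
    by-index k k<n k′ k′<n refl refl e = subst (λ j → proj₁ (T.at k) < proj₁ (U.at j))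
      (+-injective (+-cancelˡ-≡ c (trans (sym (T.level-at k<n)) (trans e (U.level-at k′<n))))) (along k k<n)

  LeftOf⇒≺ᵗ : Disjoint t u → LeftOf t u → t ≺ᵗ u
  LeftOf⇒≺ᵗ disj left = (λ { refl → disj (T.at∈ 0 , T.at∈ 0) }) ,
    lose (T.at∈ 0) (lose (U.at∈ 0)
      (inj₁ (same-level 0<n , left _ _ (T.at∈ 0) (U.at∈ 0) (same-level 0<n))))

  -- Suppose s₁ ≺ s₂ on different levels. On the level of the lower square, the other tile has a
  -- square from which it steps to the upper one. Such a step moves x by at most one, too little to
  -- reverse the order of the tiles.
  LeftOf⇒⊀ᵗ : LeftOf u t → ¬ (t ≺ᵗ u)
  LeftOf⇒⊀ᵗ left (_ , any) with find any
  ... | s₁ , s₁∈ , any′ with find any′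
  ...   | s₂ , s₂∈ , s₁≺s₂ with ≺⇒⊴ s₁≺s₂ | ≺⇒Near s₁≺s₂ | <-cmp (level s₁) (level s₂)
  ...     | x≤ , y≤ | lo , hi | tri≈ _ e _ = <⇒≱ (left _ _ s₂∈ s₁∈ (sym e)) x≤
  -- Here x₂ ≤ x₁ follows, and with y₂ ≤ y₁ the level of s₂ could not exceed that of s₁.
  ...     | x≤ , y≤ | lo , hi | tri< l< _ _ =
              let s , s∈ , ls = U.square-at (proj₁ (T.in-range s₁∈)) (proj₂ (T.in-range s₁∈))
                  s′ , s′∈ , s↗s′ = U.next s∈
                    (≤-<-trans (≤-trans (≡⇒≤ (cong sucℤ ls)) (below l<)) (proj₂ (U.in-range s₂∈)))
                  s′≡s₂ = U.level-injective s′∈ s₂∈ (trans (level-↗ s↗s′)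
                            (trans (cong sucℤ ls) (≤-antisym (below l<) hi)))
                  x₂≤ = ≤-trans (≡⇒≥ (cong proj₁ s′≡s₂)) (proj₂ (↗-mono-≤ s↗s′))
              in <⇒≱ l< (+-mono-≤ (≤-trans x₂≤ (below (left _ _ s∈ s₁∈ ls))) y≤)
  ...     | x≤ , y≤ | lo , hi | tri> _ _ l> =
              let s , s∈ , ls = T.square-at (proj₁ (U.in-range s₂∈)) (proj₂ (U.in-range s₂∈))
                  s′ , s′∈ , s↗s′ = T.next s∈
                    (≤-<-trans (≤-trans (≡⇒≤ (cong sucℤ ls)) (below l>)) (proj₂ (T.in-range s₁∈)))
                  s′≡s₁ = T.level-injective s′∈ s₁∈ (trans (level-↗ s↗s′)
                            (trans (cong sucℤ ls) (≤-antisym (below l>) lo)))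
              in <⇒≱ (<-≤-trans (left _ _ s₂∈ s∈ (sym ls))
                        (≤-trans (proj₁ (↗-mono-≤ s↗s′)) (≡⇒≤ (cong proj₁ s′≡s₁)))) x≤

LeftOf-total : ∀ {n c t u} .{{_ : NonZero n}} → Ribbon n c t → Ribbon n c u → Disjoint t u →
  LeftOf t u ⊎ LeftOf u t
LeftOf-total {n} r q disj with <-cmp (proj₁ (Ribbon.at r 0)) (proj₁ (Ribbon.at q 0))
... | tri< lt _ _ = inj₁ (bottom-left⇒LeftOf r q disj lt)
... | tri> _ _ gt = inj₂ (bottom-left⇒LeftOf q r (λ (a , b) → disj (b , a)) gt)
... | tri≈ _ eq _ = contradiction
  (Ribbon.at∈ r 0 , subst (_∈ _)
    (sym (≡-on-level (trans (Ribbon.level-at r 0<n) (sym (Ribbon.level-at q 0<n))) eq)) (Ribbon.at∈ q 0))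
  disj
  where
  0<n : 0 ℕ.< n
  0<n = ℕ.>-nonZero⁻¹ n

≺ᵗ⇒LeftOf : ∀ {n c t u} .{{_ : NonZero n}} → Ribbon n c t → Ribbon n c u → Disjoint t u →
  t ≺ᵗ u → LeftOf t u
≺ᵗ⇒LeftOf r q disj t≺u with LeftOf-total r q disj
... | inj₁ left  = left
... | inj₂ right = contradiction t≺u (LeftOf⇒⊀ᵗ r q right)

module Levels {n} .{{_ : NonZero n}} {R α} (tiling : RibbonTiling n R α) where
  open Tiling tiling public

  tile-of-level : ∀ {c t} → t ∈ tilesOfLevel c α → t ∈ α × Ribbon n c t
  tile-of-level {c} {t} t∈ =
    let t∈α , h = ∈-filter⁻ (hasLevel? c) {xs = α} t∈ ; c′ , r = tile⇒ribbon t∈α in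
    t∈α , subst (λ k → Ribbon n k t) (ribbon-level r h) r

  distinct⇒Disjoint : ∀ {t u} → t ∈ α → u ∈ α → t ≢ u → Disjoint t u
  distinct⇒Disjoint t∈ u∈ t≢u (s∈t , s∈u) = t≢u (same-tile t∈ u∈ s∈t s∈u)

  leftToRight : ∀ c → ∃[ ts ] LeftToRight α c ts
  leftToRight c =
    let ts , p , l = hamiltonian (pairs (All.tabulate (λ t∈ → proj₂ (tile-of-level t∈)))
                                        (AllPairsₚ.filter⁺ (hasLevel? c) (RibbonTiling.disjoint tiling)))
    in ts , record { tiles = p ; ordered = l }
    where
    compare : ∀ {t u} → Ribbon n c t → Ribbon n c u → Disjoint t u → t ≺ᵗ u ⊎ u ≺ᵗ t
    compare r q disj with LeftOf-total r q disj
    ... | inj₁ left  = inj₁ (LeftOf⇒≺ᵗ r q disj left)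
    ... | inj₂ right = inj₂ (LeftOf⇒≺ᵗ q r (λ (a , b) → disj (b , a)) right)
    open All.All using ([]; _∷_)
    open AllPairs.AllPairs using ([]; _∷_)
    row : ∀ {t xs} → Ribbon n c t → All (Ribbon n c) xs → All (Disjoint t) xs →
      All (λ u → t ≺ᵗ u ⊎ u ≺ᵗ t) xs
    row r []       []       = []
    row r (q ∷ qs) (d ∷ ds) = compare r q d ∷ row r qs ds
    pairs : ∀ {xs} → All (Ribbon n c) xs → AllPairs Disjoint xs →
      AllPairs (λ t u → t ≺ᵗ u ⊎ u ≺ᵗ t) xs
    pairs []       []       = []
    pairs (r ∷ rs) (d ∷ ds) = row r rs d ∷ pairs rs ds

  module _ {c ts} (sorted : LeftToRight α c ts) where
    open LeftToRight sorted

    sorted-tile : ∀ {t} → t ∈ ts → t ∈ α × Ribbon n c t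
    sorted-tile t∈ = tile-of-level (∈-resp-↭ tiles t∈)

    sorted-LeftOf : Linked LeftOf ts
    sorted-LeftOf = linked-map
      (λ (t∈ , r) (u∈ , q) t≺u → ≺ᵗ⇒LeftOf r q (distinct⇒Disjoint t∈ u∈ (proj₁ t≺u)) t≺u)
      (All.tabulate sorted-tile) ordered

  isTile⇒tile : ∀ {c i t} → IsTile α c i t → t ∈ α × Ribbon n c t
  isTile⇒tile (ts , sorted , k , _ , refl) = sorted-tile sorted (∈-lookup k)

  Rightward : ℤ → (SquareSet → Set) → Set
  Rightward c P = ∀ {t u} → Ribbon n c t → Ribbon n c u → LeftOf t u → P t → P u

  module _ {c} {P : SquareSet → Set} (P? : Decidable P) (rightward : Rightward c P) where

    private
      upward : ∀ {ts} → LeftToRight α c ts → Linked (λ t u → P t → P u) ts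
      upward sorted = linked-map (λ r q left → rightward r q left)
        (All.tabulate (λ t∈ → proj₂ (sorted-tile sorted t∈))) (sorted-LeftOf sorted)

      lengths : ∀ {ts} → LeftToRight α c ts → length ts ≡ length (tilesOfLevel c α)
      lengths sorted = ↭-length (LeftToRight.tiles sorted)

      counts : ∀ {ts} → LeftToRight α c ts → length (filter P? ts) ≡ count P? c α
      counts sorted = ↭-length (filter-↭ P? (LeftToRight.tiles sorted))

    -- A property that passes to the right holds for the last tiles of the level. Whether the i-th
    -- tile has it thus depends on i and two counts only, and these can be compared between tilings.
    isTile-criterion : ∀ {i t} → IsTile α c i t →
      P t ⇔ length (tilesOfLevel c α) ℕ.< i ℕ.+ count P? c α
    isTile-criterion (ts , sorted , k , refl , refl)
      rewrite sym (lengths sorted) | sym (counts sorted) = mk⇔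
        (λ p → s≤s (Equivalence.to (upward-lookup P? (upward sorted) k) p))
        (λ { (s≤s h) → Equivalence.from (upward-lookup P? (upward sorted) k) h })

    isTile-first : ∀ {i u} → IsTile α c i u → P u → (∀ {t} → LeftOf t u → ¬ P t) →
      i ℕ.+ count P? c α ≡ suc (length (tilesOfLevel c α))
    isTile-first (ts , sorted , k , refl , refl) pu first
      rewrite sym (lengths sorted) | sym (counts sorted) = cong suc
        (upward-first P? (upward sorted) k pu λ k′ e →
          first (linked-lookup (sorted-LeftOf sorted) k k′ e))

-- Tiles on one side of a square

meets-rightward : ∀ {n} .{{_ : NonZero n}} {c l} {Q : Square → Set} → c ≤ l → l < c + + n →
  (∀ {s s′} → level s ≡ level s′ → proj₁ s < proj₁ s′ → Q s → Q s′) →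
  ∀ {t u} → Ribbon n c t → Ribbon n c u → LeftOf t u → Meets l Q t → Meets l Q u
meets-rightward c≤l l< mono r q left m =
  let s , s∈ , e , qs = find m ; s′ , s′∈ , e′ = Ribbon.square-at q c≤l l< ; ee = trans e (sym e′) in
  lose s′∈ (e′ , mono ee (left _ _ s∈ s′∈ ee) qs)

⊴-rightward : ∀ {p s s′} → level s ≡ level s′ → proj₁ s < proj₁ s′ → p ⊴ s → p ⊴ s′
⊴-rightward {p} {x , y} {x′ , y′} e x<x′ (a≤ , y≤) = ≤-trans a≤ (<⇒≤ x<x′) ,
  ≤-trans (i+j≡k+m⇒m≤j e (<⇒≤ x<x′)) y≤

NearLevel : Square → ℤ → Set
NearLevel b l = level b ≤ sucℤ l × l ≤ sucℤ (level b)

module _ {n} .{{_ : NonZero n}} {c b t u} (r : Ribbon n c t) (q : Ribbon n c u)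
         (outside : ∀ {s} → s ∈ u → s ≢ b)
         (transfer : ∀ {l} → c ≤ l → l < c + + n → NearLevel b l →
           Meets l (b ⊴_) t ⇔ Meets l (b ⊴_) u) where
  private
    module T = Ribbon r
    module U = Ribbon q

  ≺ˢᵗ-transfer : b ≺ˢᵗ t → b ≺ˢᵗ u
  ≺ˢᵗ-transfer b≺t with find b≺t
  ... | s , s∈ , b≺s with find (Equivalence.to
      (transfer (proj₁ (T.in-range s∈)) (proj₂ (T.in-range s∈)) (≺⇒Near b≺s))
      (lose s∈ (refl , ≺⇒⊴ b≺s)))
  ...   | s′ , s′∈ , e , b⊴s′ = lose s′∈
      (⊴⇒≺ (subst (NearLevel b) (sym e) (≺⇒Near b≺s)) (λ e → outside s′∈ (sym e)) b⊴s′)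

  -- The square of u on the level of s is comparable with b. If b preceded it, `transfer` would
  -- place b weakly before s, contrary to s ≺ b.
  ≺ᵗˢ-transfer : t ≺ᵗˢ b → u ≺ᵗˢ b
  ≺ᵗˢ-transfer t≺b with find t≺b
  ... | s , s∈ , s≺b with U.square-at (proj₁ (T.in-range s∈)) (proj₂ (T.in-range s∈))
  ...   | s′ , s′∈ , e = go (≺-total (swap (subst (NearLevel b) (sym e) near)) (outside s′∈))
    where
    near : NearLevel b (level s)
    near = swap (≺⇒Near s≺b)
    go : s′ ≺ b ⊎ b ≺ s′ → u ≺ᵗˢ b
    go (inj₁ s′≺b) = lose s′∈ s′≺b
    go (inj₂ b≺s′) with find (Equivalence.from
      (transfer (proj₁ (T.in-range s∈)) (proj₂ (T.in-range s∈)) near)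
      (lose s′∈ (e , ≺⇒⊴ b≺s′)))
    ... | s″ , s″∈ , e″ , b⊴s″ = contradiction
      (subst (b ⊴_) (T.level-injective s″∈ s∈ e″) b⊴s″) (≺⇒⋭ s≺b)

-- Comparison of two tilings: numbers of tiles and boundary squares

module Pair {n} .{{_ : NonZero n}} {R} (region : SimplyConnectedRegion R)
            {α β} (tα : RibbonTiling n R α) (tβ : RibbonTiling n R β) where
  module α = Levels tα
  module β = Levels tβ

  tilesOfLevel-length : ∀ c → length (tilesOfLevel c α) ≡ length (tilesOfLevel c β)
  tilesOfLevel-length c = trans (all-counted tα) (trans
    (count-invariant (everywhere R c) ≤-refl (i<i+n n c) tα tβ) (sym (all-counted tβ)))
    where
    all-counted : ∀ {γ} → RibbonTiling n R γ →
      length (tilesOfLevel c γ) ≡ count (meets? c {λ _ → ⊤} (λ _ → yes tt)) c γ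
    all-counted tγ = cong length (sym (filter-all (meets? c (λ _ → yes tt)) (All.tabulate λ t∈ →
      let s , s∈ , e = Ribbon.square-at (proj₂ (Levels.tile-of-level tγ t∈)) ≤-refl (i<i+n n c)
      in lose s∈ (e , tt))))

  defined : ∀ c i → IsDefined α c i → IsDefined β c i
  defined c i (_ , ts , sorted , k , e , _) =
    let ts′ , sorted′ = β.leftToRight c
        k<′ = subst (toℕ k ℕ.<_) (trans (↭-length (LeftToRight.tiles sorted))
                (trans (tilesOfLevel-length c) (sym (↭-length (LeftToRight.tiles sorted′))))) (toℕ<n k)
    in _ , ts′ , sorted′ , fromℕ< k<′ , trans (cong suc (toℕ-fromℕ< k<′)) e , refl

  transfer : ∀ {c i P Q} (P? : Decidable P) (Q? : Decidable Q) → α.Rightward c P → β.Rightward c Q →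
    count P? c α ≡ count Q? c β → ∀ {t u} → IsTile α c i t → IsTile β c i u → P t ⇔ Q u
  transfer {c} {i} P? Q? up uq eq it iu = mk⇔
    (λ p → from (β.isTile-criterion Q? uq iu)
      (subst₂ ℕ._<_ (tilesOfLevel-length c) (cong (i ℕ.+_) eq)
        (to (α.isTile-criterion P? up it) p)))
    (λ q → from (α.isTile-criterion P? up it)
      (subst₂ ℕ._<_ (sym (tilesOfLevel-length c)) (cong (i ℕ.+_) (sym eq))
        (to (β.isTile-criterion Q? uq iu) q)))
    where
    open Equivalence

  southEast-transfer : ∀ {p s₀} → p ∉ R → s₀ ∈ R → ∀ {c l} → c ≤ l → l < c + + n →
    level p ≤ sucℤ l → l ≤ sucℤ (level p) → ∀ {i t u} → IsTile α c i t → IsTile β c i u →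
    Meets l (p ⊴_) t ⇔ Meets l (p ⊴_) u
  southEast-transfer {p} p∉ s₀∈ {c} {l} c≤l l< near near′ = transfer
    (meets? l (southEast? p)) (meets? l (southEast? p))
    (meets-rightward c≤l l< ⊴-rightward) (meets-rightward c≤l l< ⊴-rightward)
    (count-invariant (southEast region p∉ s₀∈ near near′) c≤l l< tα tβ)

  module _ {b} (boundary : Boundary R b) {c i t u} (it : IsTile α c i t) (iu : IsTile β c i u) where

    private
      outside : ∀ {s} → s ∈ u → s ≢ b
      outside s∈ refl = proj₁ boundary (β.tile⊆R (proj₁ (β.isTile⇒tile iu)) s∈)

      same-side : ∀ {l} → c ≤ l → l < c + + n → NearLevel b l →
        Meets l (b ⊴_) t ⇔ Meets l (b ⊴_) u
      same-side c≤l l< (lo , hi) = southEast-transfer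
        (proj₁ boundary) (proj₁ (proj₂ (proj₂ boundary))) c≤l l< lo hi it iu

    boundary-transfer : ((t ≺ᵗˢ b) → (u ≺ᵗˢ b)) × ((b ≺ˢᵗ t) → (b ≺ˢᵗ u))
    boundary-transfer =
      ≺ᵗˢ-transfer (proj₂ (α.isTile⇒tile it)) (proj₂ (β.isTile⇒tile iu)) outside same-side ,
      ≺ˢᵗ-transfer (proj₂ (α.isTile⇒tile it)) (proj₂ (β.isTile⇒tile iu)) outside same-side

-- Tiles whose levels differ by n

EastOf : ℤ → Square → Set
EastOf x s = x ≤ proj₁ s

eastOf? : ∀ x → Decidable (EastOf x)
eastOf? x s = x ≤? proj₁ s

EastOf-rightward : ∀ {x s s′} → level s ≡ level s′ → proj₁ s < proj₁ s′ → EastOf x s → EastOf x s′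
EastOf-rightward _ x<x′ x≤ = ≤-trans x≤ (<⇒≤ x<x′)

∑-minus : ∀ v w S → ∑ (λ s → v s - w s) S ≡ ∑ v S - ∑ w S
∑-minus v w S = Sum-minus v w (deduplicate _≟ˢ_ S)

stripWeight : ℤ → ℤ → Square → ℤ
stripWeight l x s = ind (at-level? l (eastOf? x) s) - ind (at-level? (sucℤ l) (eastOf? x) s)

≤∧≢suc⇒≤ : ∀ {i j} → i ≤ sucℤ j → i ≢ sucℤ j → i ≤ j
≤∧≢suc⇒≤ h i≢ = i<1+j⇒i≤j (≤∧≢⇒< h i≢)

+-cancelʳ-≡ : ∀ k {i j} → i + k ≡ j + k → i ≡ j
+-cancelʳ-≡ k {i} {j} h = +-cancelˡ-≡ k (trans (+-comm k i) (trans h (+-comm j k)))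

≺ᵗ-elim : ∀ {t u} {C : Set} → (∀ {s s′} → s ∈ t → s′ ∈ u → s ≺ s′ → C) → t ≺ᵗ u → C
≺ᵗ-elim {t} {u} {C} f (_ , any) = outer (λ s∈ → inner (f s∈)) any
  where
  inner : ∀ {s v} → (∀ {s′} → s′ ∈ v → s ≺ s′ → C) → Any (s ≺_) v → C
  inner g (here p)  = g (here refl) p
  inner g (there a) = inner (λ s′∈ → g (there s′∈)) a
  outer : ∀ {v} → (∀ {s} → s ∈ v → Any (s ≺_) u → C) → Any (λ s → Any (s ≺_) u) v → C
  outer g (here p)  = g (here refl) p
  outer g (there a) = outer (λ s∈ → g (there s∈)) a

-- The strip consists of the levels l and l + 1 = c + n: tiles of level c end on its lower level,
-- and u starts on its upper level in the square s₁.
module Strip {n} .{{_ : NonZero n}} {R α} (tiling : RibbonTiling n R α)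
             {c l} (c+n≡ : c + + n ≡ sucℤ l) {u s₁} (u∈ : u ∈ α) (q : Ribbon n (sucℤ l) u)
             (s₁∈ : s₁ ∈ u) (level-s₁ : level s₁ ≡ sucℤ l) where
  open Levels tiling

  x : ℤ
  x = proj₁ s₁

  private
    E? = meets? l (eastOf? x)
    S? = meets? (sucℤ l) (eastOf? x)

  c≤l : c ≤ l
  c≤l = i<1+j⇒i≤j (subst (c <_) c+n≡ (i<i+n n c))

  l<c+n : l < c + + n
  l<c+n = subst (l <_) (sym c+n≡) (i≤j⇒i<1+j (≤-refl {l}))

  c≢suc : c ≢ sucℤ l
  c≢suc e = <⇒≢ (i<i+n n c) (trans e (sym c+n≡))

  module _ {c′ t} (t∈ : t ∈ α) (r : Ribbon n c′ t) (c′≢c : c′ ≢ c) (c′≢suc : c′ ≢ sucℤ l) where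
    open Ribbon r

    -- As its level is not c, the tile does not end on level l, and its next step does not decrease
    -- x.
    EastOf-next : Meets l (EastOf x) t → Meets (sucℤ l) (EastOf x) t
    EastOf-next m with find m
    ... | s , s∈ , refl , x≤ with next s∈ (≤∧≢⇒< (below (proj₂ (in-range s∈)))
              λ eq → c′≢c (+-cancelʳ-≡ (+ n) (trans (sym eq) (sym c+n≡))))
    ...   | s′ , s′∈ , s↗s′ = lose s′∈ (level-↗ s↗s′ , ≤-trans x≤ (proj₁ (↗-mono-≤ s↗s′)))

    -- An east step can only enter the half-plane x ≤ _ at s₁ itself.
    EastOf-back : ∀ {s s′} → s ↗ s′ → s′ ∈ t → level s′ ≡ sucℤ l → EastOf x s′ → EastOf x s
    EastOf-back north s′∈ e x≤ = x≤
    EastOf-back east  s′∈ e x≤ = ≤∧≢suc⇒≤ x≤ λ eq → c′≢suc (ribbon-level r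
      (subst (HasLevel (sucℤ l))
        (same-tile u∈ t∈ (subst (_∈ u) (≡-on-level (trans level-s₁ (sym e)) eq) s₁∈) s′∈)
        (Ribbon.hasLevel q)))

    EastOf-previous : Meets (sucℤ l) (EastOf x) t → Meets l (EastOf x) t
    EastOf-previous m with find m
    ... | s′ , s′∈ , e′ , x≤ with square-at
            (≤∧≢suc⇒≤ (subst (c′ ≤_) e′ (proj₁ (in-range s′∈))) c′≢suc)
            (<-trans (i≤j⇒i<1+j (≤-refl {l})) (subst (_< c′ + + n) e′ (proj₂ (in-range s′∈))))
    ...   | s , s∈ , refl with next s∈ (subst (_< c′ + + n) e′ (proj₂ (in-range s′∈)))
    ...     | s″ , s″∈ , s↗s″ = lose s∈ (refl , EastOf-back
                (subst (s ↗_) (level-injective s″∈ s′∈ (trans (level-↗ s↗s″) (sym e′))) s↗s″) s′∈ e′ x≤)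

  -- A tile of level c meets only the lower level of the strip and a tile of level l + 1 only the
  -- upper one. Any other tile has two strip squares east of x or none, so it contributes zero.
  tile-balance : ∀ {t} → t ∈ α →
    ind (hasLevel? c t ×-dec E? t) - ind (hasLevel? (sucℤ l) t ×-dec S? t) ≡ ∑ (stripWeight l x) t
  tile-balance {t} t∈ with tile⇒ribbon t∈
  ... | c′ , r = sym (trans
          (∑-minus (λ s → ind (at-level? l (eastOf? x) s)) (λ s → ind (at-level? (sucℤ l) (eastOf? x) s)) t)
          (trans (cong₂ _-_ (∑-meets r l (eastOf? x)) (∑-meets r (sucℤ l) (eastOf? x)))
          (cases (c′ ≟ c) (c′ ≟ sucℤ l))))
    where
    open Ribbon r
    no-S : c′ ≡ c → ¬ Meets (sucℤ l) (EastOf x) t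
    no-S refl m with find m
    ... | s , s∈ , e , _ = <⇒≢ (proj₂ (in-range s∈)) (trans e (sym c+n≡))
    no-E : c′ ≡ sucℤ l → ¬ Meets l (EastOf x) t
    no-E refl m with find m
    ... | s , s∈ , refl , _ = <⇒≱ (i≤j⇒i<1+j ≤-refl) (proj₁ (in-range s∈))
    cases : Dec (c′ ≡ c) → Dec (c′ ≡ sucℤ l) →
      ind (E? t) - ind (S? t) ≡ ind (hasLevel? c t ×-dec E? t) - ind (hasLevel? (sucℤ l) t ×-dec S? t)
    cases (yes c′≡c) _ = cong₂ _-_
      (ind-cong (E? t) (hasLevel? c t ×-dec E? t)
        (λ m → subst (λ k → HasLevel k t) c′≡c hasLevel , m) proj₂)
      (ind-cong (S? t) (hasLevel? (sucℤ l) t ×-dec S? t) (λ m → contradiction m (no-S c′≡c)) proj₂)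
    cases (no _) (yes c′≡) = cong₂ _-_
      (ind-cong (E? t) (hasLevel? c t ×-dec E? t) (λ m → contradiction m (no-E c′≡)) proj₂)
      (ind-cong (S? t) (hasLevel? (sucℤ l) t ×-dec S? t)
        (λ m → subst (λ k → HasLevel k t) c′≡ hasLevel , m) proj₂)
    cases (no c′≢c) (no c′≢suc) = trans
      (trans (cong (λ i → ind (E? t) - i)
               (sym (ind-cong (E? t) (S? t) (EastOf-next t∈ r c′≢c c′≢suc)
                                            (EastOf-previous t∈ r c′≢c c′≢suc))))
             (+-inverseʳ (ind (E? t))))
      (sym (cong₂ _-_
        (ind-no (hasLevel? c t ×-dec E? t) λ (h , _) → c′≢c (ribbon-level r h))
        (ind-no (hasLevel? (sucℤ l) t ×-dec S? t) λ (h , _) → c′≢suc (ribbon-level r h))))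

  strip-count : + count E? c α - + count S? (sucℤ l) α ≡ ∑ (stripWeight l x) R
  strip-count = begin
    + count E? c α - + count S? (sucℤ l) α
      ≡⟨ cong₂ _-_ (count≡Sum E? c α) (count≡Sum S? (sucℤ l) α) ⟩
    Sum (λ t → ind (hasLevel? c t ×-dec E? t)) α - Sum (λ t → ind (hasLevel? (sucℤ l) t ×-dec S? t)) α
      ≡⟨ Sum-minus (λ t → ind (hasLevel? c t ×-dec E? t))
                   (λ t → ind (hasLevel? (sucℤ l) t ×-dec S? t)) α ⟨
    Sum (λ t → ind (hasLevel? c t ×-dec E? t) - ind (hasLevel? (sucℤ l) t ×-dec S? t)) α
      ≡⟨ Sum-cong tile-balance ⟩
    Sum (∑ (stripWeight l x)) α
      ≡⟨ ∑-tiling (stripWeight l x) ⟨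
    ∑ (stripWeight l x) R ∎
    where open ≡-Reasoning

  module _ {t} (r : Ribbon n c t) where
    private
      module T = Ribbon r
      module U = Ribbon q

    t≢u : t ≢ u
    t≢u refl = c≢suc (ribbon-level r U.hasLevel)

    -- The levels of t are at most l and those of u at least l + 1, so the two tiles can be compared
    -- only at the top of t and the bottom of u.
    facing : ∀ {s s′} → s ∈ t → s′ ∈ u → Near s s′ → level s ≡ l × s′ ≡ s₁
    facing {s} {s′} s∈ s′∈ (_ , hi) = ≤-antisym s≤l (1+i≤1+j⇒i≤j (≤-trans s′≥ hi)) ,
      U.level-injective s′∈ s₁∈ (trans (≤-antisym (≤-trans hi (+-monoʳ-≤ 1ℤ s≤l)) s′≥) (sym level-s₁))
      where
      s≤l : level s ≤ l
      s≤l = i<1+j⇒i≤j (<-≤-trans (proj₂ (T.in-range s∈)) (≡⇒≤ c+n≡))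
      s′≥ : sucℤ l ≤ level s′
      s′≥ = proj₁ (U.in-range s′∈)

    ⊴⇒¬EastOf : ∀ {s} → level s ≡ l → s ⊴ s₁ → ¬ EastOf x s
    ⊴⇒¬EastOf e (_ , y≤) x≤ = <⇒≱ (suc[i]≤j⇒i<j (≡⇒≥ level-s₁)) (≤-trans (+-mono-≤ x≤ y≤) (≡⇒≤ e))

    face : ∃[ s ] s ∈ t × level s ≡ l × (s ≺ s₁ ⊎ s₁ ≺ s)
    face with T.square-at c≤l l<c+n
    ... | s , s∈ , e = s , s∈ , e , ≺-total near
            λ { refl → <⇒≢ (i≤j⇒i<1+j (≤-refl {l})) (trans (sym e) level-s₁) }
      where
      near : Near s s₁
      near = ≤-trans (≡⇒≤ e) (≤-trans (i≤suc[i] l) (≤-trans (≡⇒≥ level-s₁) (i≤suc[i] (level s₁)))) ,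
             ≤-trans (≡⇒≤ level-s₁) (≡⇒≥ (cong sucℤ e))

    ≺ᵗ⇔¬EastOf : t ≺ᵗ u ⇔ (¬ Meets l (EastOf x) t)
    ≺ᵗ⇔¬EastOf = mk⇔ to from
      where
      to : t ≺ᵗ u → ¬ Meets l (EastOf x) t
      to t≺u m = ≺ᵗ-elim (λ {s} s∈ s′∈ s≺s′ → let e , s′≡s₁ = facing s∈ s′∈ (≺⇒Near s≺s′) in
        ⊴⇒¬EastOf e (≺⇒⊴ (subst (s ≺_) s′≡s₁ s≺s′)) (meets-at r s∈ e m)) t≺u
      from : ¬ Meets l (EastOf x) t → t ≺ᵗ u
      from ¬m = let s , s∈ , e , comparison = face in go s∈ e comparison
        where
        go : ∀ {s} → s ∈ t → level s ≡ l → s ≺ s₁ ⊎ s₁ ≺ s → t ≺ᵗ u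
        go s∈ e (inj₁ s≺s₁) = t≢u , lose s∈ (lose s₁∈ s≺s₁)
        go s∈ e (inj₂ s₁≺s) = contradiction (lose s∈ (e , proj₁ (≺⇒⊴ s₁≺s))) ¬m

    ≻ᵗ⇔EastOf : u ≺ᵗ t ⇔ Meets l (EastOf x) t
    ≻ᵗ⇔EastOf = mk⇔ to from
      where
      to : u ≺ᵗ t → Meets l (EastOf x) t
      to = ≺ᵗ-elim λ {_} {s} s′∈ s∈ s′≺s → let e , s′≡s₁ = facing s∈ s′∈ (swap (≺⇒Near s′≺s)) in
        lose s∈ (e , proj₁ (≺⇒⊴ (subst (_≺ s) s′≡s₁ s′≺s)))
      from : Meets l (EastOf x) t → u ≺ᵗ t
      from m = let s , s∈ , e , comparison = face in go s∈ e comparison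
        where
        go : ∀ {s} → s ∈ t → level s ≡ l → s ≺ s₁ ⊎ s₁ ≺ s → u ≺ᵗ t
        go s∈ e (inj₂ s₁≺s) = (λ e → t≢u (sym e)) , lose s₁∈ (lose s∈ s₁≺s)
        go s∈ e (inj₁ s≺s₁) = contradiction (meets-at r s∈ e m) (⊴⇒¬EastOf e (≺⇒⊴ s≺s₁))

-- Moving the cut along the strip

level-column : ∀ x l → level (x , l - x) ≡ l
level-column = i+[j-i]≡j

column : ∀ l x s →
  ind (at-level? l (eastOf? x) s) - ind (at-level? l (eastOf? (sucℤ x)) s) ≡ ind (s ≟ˢ (x , l - x))
column l x s = cases (level s ≟ l) (<-cmp x (proj₁ s))
  where
  differ : ∀ {P Q S : Set} (P? : Dec P) (Q? : Dec Q) (S? : Dec S) {i j k} →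
    ind P? ≡ i → ind Q? ≡ j → ind S? ≡ k → i - j ≡ k → ind P? - ind Q? ≡ ind S?
  differ _ _ _ refl refl refl e = e
  A? = at-level? l (eastOf? x) s
  B? = at-level? l (eastOf? (sucℤ x)) s
  C? = s ≟ˢ (x , l - x)
  cases : Dec (level s ≡ l) → _ → ind A? - ind B? ≡ ind C?
  cases (no l≢) _ = differ A? B? C? (ind-no A? λ (e , _) → l≢ e) (ind-no B? λ (e , _) → l≢ e)
    (ind-no C? λ e → l≢ (trans (cong level e) (level-column x l))) refl
  cases (yes e) (tri< x< x≢ _) = differ A? B? C? (ind-yes A? (e , <⇒≤ x<)) (ind-yes B? (e , below x<))
    (ind-no C? λ e′ → x≢ (sym (cong proj₁ e′))) refl
  cases (yes e) (tri≈ _ x≡ _) = differ A? B? C? (ind-yes A? (e , ≡⇒≤ x≡))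
    (ind-no B? λ (_ , x<) → <⇒≢ (suc[i]≤j⇒i<j x<) x≡)
    (ind-yes C? (≡-on-level (trans e (sym (level-column x l))) (sym x≡))) refl
  cases (yes e) (tri> _ x≢ x>) = differ A? B? C? (ind-no A? λ (_ , x≤) → <⇒≱ x> x≤)
    (ind-no B? λ (_ , x<) → <-asym x> (suc[i]≤j⇒i<j x<)) (ind-no C? λ e′ → x≢ (sym (cong proj₁ e′))) refl

column-sum : ∀ {R} l x → (x , l - x) ∈ R →
  ∑ (λ s → ind (at-level? l (eastOf? x) s)) R ≡
  1ℤ + ∑ (λ s → ind (at-level? l (eastOf? (sucℤ x)) s)) R
column-sum {R} l x m∈ = i-j≡1⇒ {∑ v R} {∑ w R} (trans (sym (∑-minus v w R))
  (trans (∑-cong {S = R} (λ {s} _ → column l x s))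
  (trans (∑-ind (_≟ˢ (x , l - x)) {R} (λ _ _ e e′ → trans e (sym e′)))
         (ind-yes (any? (_≟ˢ (x , l - x)) R) (lose m∈ refl)))))
  where
  v w : Square → ℤ
  v s = ind (at-level? l (eastOf? x) s)
  w s = ind (at-level? l (eastOf? (sucℤ x)) s)

InStrip : SquareSet → ℤ → ℤ → Set
InStrip R l z = (z , l - z) ∈ R × (z , sucℤ l - z) ∈ R

-- Passing column x loses one square of R on each of the two levels, and these losses cancel in the
-- difference.
strip-shift : ∀ {R l x} → InStrip R l x → ∑ (stripWeight l x) R ≡ ∑ (stripWeight l (sucℤ x)) R
strip-shift {R} {l} {x} (m∈ , m′∈) = trans (∑-minus (δ l x) (δ (sucℤ l) x) R)
  (trans (cong₂ _-_ (column-sum l x m∈) (column-sum (sucℤ l) x m′∈))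
  (trans (cancel (∑ (δ l (sucℤ x)) R) (∑ (δ (sucℤ l) (sucℤ x)) R))
         (sym (∑-minus (δ l (sucℤ x)) (δ (sucℤ l) (sucℤ x)) R))))
  where
  δ : ℤ → ℤ → Square → ℤ
  δ l x s = ind (at-level? l (eastOf? x) s)
  cancel : ∀ i j → 1ℤ + i - (1ℤ + j) ≡ i - j
  cancel i j = solve (i ∷ j ∷ [])

strip-shifts : ∀ {R l} k x → (∀ {z} → x ≤ z → z < x + + k → InStrip R l z) →
  ∑ (stripWeight l x) R ≡ ∑ (stripWeight l (x + + k)) R
strip-shifts {R} {l} zero    x full = cong (λ z → ∑ (stripWeight l z) R) (sym (+-identityʳ x))
strip-shifts {R} {l} (suc k) x full = trans (strip-shift (full ≤-refl x<))
  (trans (strip-shifts k (sucℤ x) λ {z} lo hi →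
           full (≤-trans (i≤suc[i] x) lo) (subst (z <_) (sym (shift x (+ k))) hi))
         (cong (λ z → ∑ (stripWeight l z) R) (sym (shift x (+ k)))))
  where
  shift : ∀ i j → i + (1ℤ + j) ≡ 1ℤ + i + j
  shift i j = solve (i ∷ j ∷ [])
  x< : x < x + + suc k
  x< = subst (_< x + + suc k) (+-identityʳ x) (+-monoʳ-< x (+<+ (s≤s z≤n)))

strip-constant : ∀ {R l x x′} → x ≤ x′ → (∀ {z} → x ≤ z → z < x′ → InStrip R l z) →
  ∑ (stripWeight l x) R ≡ ∑ (stripWeight l x′) R
strip-constant {R} {l} {x} {x′} x≤x′ full = trans
  (strip-shifts ∣ x′ - x ∣ x λ {z} lo hi → full lo (subst (z <_) eq hi))
  (cong (λ z → ∑ (stripWeight l z) R) eq)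
  where
  eq : x + + ∣ x′ - x ∣ ≡ x′
  eq = trans (cong (ℤ._+_ x) (0≤i⇒+∣i∣≡i (i≤j⇒0≤j-i x≤x′))) (i+[j-i]≡j x x′)

-- The strip between corresponding tiles of two tilings

module _ {n} .{{_ : NonZero n}} {R} (region : SimplyConnectedRegion R)
         {α β} (tα : RibbonTiling n R α) (tβ : RibbonTiling n R β) where
  open Pair region tα tβ

  -- A missing strip square p in this interval would have v, but not u, on its
  -- south-east side, against southEast-transfer.
  strip-between : ∀ {l i u v s₁ s₂} → IsTile α (sucℤ l) i u → IsTile β (sucℤ l) i v →
    s₁ ∈ u → s₂ ∈ v → level s₁ ≡ sucℤ l → level s₂ ≡ sucℤ l →
    ∀ {z} → proj₁ s₁ ≤ z → z < proj₁ s₂ → InStrip R l z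
  strip-between {l} {i} {u} {v} {s₁@(x₁ , y₁)} {s₂@(x₂ , y₂)} iu iv s₁∈ s₂∈ e₁ e₂ {z} x₁≤z z<x₂ =
    -- The lower square of column z lies strictly below the row of s₁, so s₁ is not to its
    -- south-east.
    decidable-stable ((z , l - z) ∈? R) (λ m∉ → <⇒≱ (lower-not x₁ y₁ e₁ x₁≤z)
      (proj₂ (only m∉ (≡⇒≤ (level-column z l) ⟨≤⟩ i≤suc[i] l ⟨≤⟩ i≤suc[i] (sucℤ l))
                      (≡⇒≤ (cong sucℤ (sym (level-column z l))))
                      (<⇒≤ z<x₂ , lower x₂ y₂ e₂ (below z<x₂))))) ,
    -- For the upper square, having s₁ to its south-east forces z = x₁; then it is s₁ itself, which
    -- lies in R.
    decidable-stable ((z , sucℤ l - z) ∈? R) (λ m∉ → m∉ (subst (_∈ R)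
      (≡-on-level (trans e₁ (sym (level-column z (sucℤ l))))
        (≤-antisym x₁≤z (proj₁ (only m∉ (≡⇒≤ (level-column z (sucℤ l)) ⟨≤⟩ i≤suc[i] (sucℤ l))
                                        (i≤suc[i] (sucℤ l) ⟨≤⟩ ≡⇒≤ (cong sucℤ (sym (level-column z (sucℤ l)))))
                                        (<⇒≤ z<x₂ , upper x₂ y₂ e₂ (<⇒≤ z<x₂))))))
      s₁∈R))
    where
    infixr 5 _⟨≤⟩_
    _⟨≤⟩_ : ∀ {i j k} → i ≤ j → j ≤ k → i ≤ k
    _⟨≤⟩_ = ≤-trans
    s₁∈R : s₁ ∈ R
    s₁∈R = α.tile⊆R (proj₁ (α.isTile⇒tile iu)) s₁∈
    only : ∀ {p} → p ∉ R → level p ≤ sucℤ (sucℤ l) → sucℤ l ≤ sucℤ (level p) → p ⊴ s₂ → p ⊴ s₁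
    only {p} p∉ lo hi p⊴s₂ = meets-at (proj₂ (α.isTile⇒tile iu)) s₁∈ e₁ (Equivalence.from
      (southEast-transfer p∉ s₁∈R ≤-refl (i<i+n n (sucℤ l)) lo hi iu iv) (lose s₂∈ (e₂ , p⊴s₂)))
    lower : ∀ x y → x + y ≡ 1ℤ + l → 1ℤ + z ≤ x → y ≤ l - z
    lower x y e h = ≤-from (≡⇒≤ e ⊕ h) (solve (x ∷ y ∷ z ∷ l ∷ []))
    lower-not : ∀ x y → x + y ≡ 1ℤ + l → x ≤ z → l - z < y
    lower-not x y e h = <-from (≡⇒≥ e ⊕ h) (solve (x ∷ y ∷ z ∷ l ∷ []))
    upper : ∀ x y → x + y ≡ 1ℤ + l → z ≤ x → y ≤ 1ℤ + l - z
    upper x y e h = ≤-from (≡⇒≤ e ⊕ h) (solve (x ∷ y ∷ z ∷ l ∷ []))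

  -- The i-th tile is the first one not left of its own lowest square, so the count is fixed by i
  -- and the number of tiles of level c, which is the same for both tilings.
  rank-transfer : ∀ {c i u v s₁ s₂} → IsTile α c i u → IsTile β c i v → s₁ ∈ u → s₂ ∈ v →
    level s₁ ≡ c → level s₂ ≡ c →
    count (meets? c (eastOf? (proj₁ s₁))) c α ≡ count (meets? c (eastOf? (proj₁ s₂))) c β
  rank-transfer {c} {i} iu iv s₁∈ s₂∈ e₁ e₂ = ℕ.+-cancelˡ-≡ i _ _ (trans (first tα iu s₁∈ e₁)
    (trans (cong suc (tilesOfLevel-length c)) (sym (first tβ iv s₂∈ e₂))))
    where
    first : ∀ {γ} (tγ : RibbonTiling n R γ) {u s} → IsTile γ c i u → s ∈ u → level s ≡ c →
      i ℕ.+ count (meets? c (eastOf? (proj₁ s))) c γ ≡ suc (length (tilesOfLevel c γ))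
    first tγ {u} {s} iu s∈ e = Levels.isTile-first tγ (meets? c (eastOf? (proj₁ s)))
      (meets-rightward ≤-refl (i<i+n n c) EastOf-rightward) iu (lose s∈ (e , ≤-refl)) not-left
      where
      not-left : ∀ {t} → LeftOf t u → ¬ Meets c (EastOf (proj₁ s)) t
      not-left left m with find m
      ... | z , z∈ , ez , x≤ = <⇒≱ (left z s z∈ s∈ (trans ez (sym e))) x≤

  strip-weights : ∀ {l i u v s₁ s₂} → IsTile α (sucℤ l) i u → IsTile β (sucℤ l) i v →
    s₁ ∈ u → s₂ ∈ v → level s₁ ≡ sucℤ l → level s₂ ≡ sucℤ l → proj₁ s₁ ≤ proj₁ s₂ →
    ∑ (stripWeight l (proj₁ s₁)) R ≡ ∑ (stripWeight l (proj₁ s₂)) R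
  strip-weights {l} {s₁ = s₁} {s₂} iu iv s₁∈ s₂∈ e₁ e₂ x₁≤x₂ =
    strip-constant x₁≤x₂ (strip-between {l} {s₁ = s₁} {s₂} iu iv s₁∈ s₂∈ e₁ e₂)

-- The parameters are those of the preceding module; they are introduced anew so that its lemmas can
-- also be applied with the two tilings exchanged.
module _ {n} .{{_ : NonZero n}} {R} (region : SimplyConnectedRegion R)
         {α β} (tα : RibbonTiling n R α) (tβ : RibbonTiling n R β) where
  open Pair region tα tβ

  strip-weights-≡ : ∀ {l i u v s₁ s₂} → IsTile α (sucℤ l) i u → IsTile β (sucℤ l) i v →
    s₁ ∈ u → s₂ ∈ v → level s₁ ≡ sucℤ l → level s₂ ≡ sucℤ l →
    ∑ (stripWeight l (proj₁ s₁)) R ≡ ∑ (stripWeight l (proj₁ s₂)) R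
  strip-weights-≡ {s₁ = s₁} {s₂} iu iv s₁∈ s₂∈ e₁ e₂ with ≤-total (proj₁ s₁) (proj₁ s₂)
  ... | inj₁ le = strip-weights region tα tβ iu iv s₁∈ s₂∈ e₁ e₂ le
  ... | inj₂ ge = sym (strip-weights region tβ tα iv iu s₂∈ s₁∈ e₂ e₁ ge)

  -- The strip sums agree, and so do the counts of tiles of level l + 1, which depend on i alone;
  -- the remaining term of the difference must agree too.
  facing-counts : ∀ {c l i u v s₁ s₂} → c + + n ≡ sucℤ l →
    IsTile α (sucℤ l) i u → IsTile β (sucℤ l) i v →
    s₁ ∈ u → s₂ ∈ v → level s₁ ≡ sucℤ l → level s₂ ≡ sucℤ l →
    count (meets? l (eastOf? (proj₁ s₁))) c α ≡ count (meets? l (eastOf? (proj₁ s₂))) c β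
  facing-counts {l = l} c+n≡ iu iv s₁∈ s₂∈ e₁ e₂ = +-injective (minus-injective
    (trans (Strip.strip-count tα c+n≡ (proj₁ (α.isTile⇒tile iu)) (proj₂ (α.isTile⇒tile iu)) s₁∈ e₁)
    (trans (strip-weights-≡ iu iv s₁∈ s₂∈ e₁ e₂)
    (sym (Strip.strip-count tβ c+n≡ (proj₁ (β.isTile⇒tile iv)) (proj₂ (β.isTile⇒tile iv)) s₂∈ e₂))))
    (cong +_ (rank-transfer region tα tβ iu iv s₁∈ s₂∈ e₁ e₂)))
    where
    minus-injective : ∀ {i j k m} → i - j ≡ k - m → j ≡ m → i ≡ k
    minus-injective {i} {j} {k} {m} e e′ = ≤-antisym
      (≤-from (≡⇒≤ e ⊕ ≡⇒≤ e′) (solve (i ∷ j ∷ k ∷ m ∷ [])))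
      (≤-from (≡⇒≥ e ⊕ ≡⇒≥ e′) (solve (i ∷ j ∷ k ∷ m ∷ [])))

  facing-transfer : ∀ {c l i j t u t′ u′} → c + + n ≡ sucℤ l → IsTile α c i t → IsTile α (sucℤ l) j u →
    IsTile β c i t′ → IsTile β (sucℤ l) j u′ → ((t ≺ᵗ u) → (t′ ≺ᵗ u′)) × ((u ≺ᵗ t) → (u′ ≺ᵗ t′))
  facing-transfer {c} {l} {t = t} {u} {t′} {u′} c+n≡ it iu it′ iu′ =
    (λ t≺u → from (Sβ.≺ᵗ⇔¬EastOf (ribbonβ it′)) λ m → to (Sα.≺ᵗ⇔¬EastOf (ribbonα it)) t≺u (from meets⇔ m)) ,
    (λ u≺t → from (Sβ.≻ᵗ⇔EastOf (ribbonβ it′)) (to meets⇔ (to (Sα.≻ᵗ⇔EastOf (ribbonα it)) u≺t)))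
    where
    open Equivalence
    ribbonα : ∀ {c i t} → IsTile α c i t → Ribbon n c t
    ribbonα it = proj₂ (α.isTile⇒tile it)
    ribbonβ : ∀ {c i t} → IsTile β c i t → Ribbon n c t
    ribbonβ it = proj₂ (β.isTile⇒tile it)
    bottomα : ∃[ s ] s ∈ u × level s ≡ sucℤ l
    bottomα = Ribbon.square-at (ribbonα iu) ≤-refl (i<i+n n (sucℤ l))
    bottomβ : ∃[ s ] s ∈ u′ × level s ≡ sucℤ l
    bottomβ = Ribbon.square-at (ribbonβ iu′) ≤-refl (i<i+n n (sucℤ l))
    module Sα = Strip tα {c} {l} c+n≡ (proj₁ (α.isTile⇒tile iu)) (ribbonα iu)
                      (proj₁ (proj₂ bottomα)) (proj₂ (proj₂ bottomα))
    module Sβ = Strip tβ {c} {l} c+n≡ (proj₁ (β.isTile⇒tile iu′)) (ribbonβ iu′)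
                      (proj₁ (proj₂ bottomβ)) (proj₂ (proj₂ bottomβ))
    meets⇔ : Meets l (EastOf Sα.x) t ⇔ Meets l (EastOf Sβ.x) t′
    meets⇔ = transfer (meets? l (eastOf? Sα.x)) (meets? l (eastOf? Sβ.x))
      (meets-rightward Sα.c≤l Sα.l<c+n EastOf-rightward)
      (meets-rightward Sα.c≤l Sα.l<c+n EastOf-rightward)
      (facing-counts c+n≡ iu iu′ (proj₁ (proj₂ bottomα)) (proj₁ (proj₂ bottomβ))
                     (proj₂ (proj₂ bottomα)) (proj₂ (proj₂ bottomβ)))
      it it′

  ≺ᵗ-same-level : ∀ {γ} (tγ : RibbonTiling n R γ) {c t u s} → t ∈ γ → u ∈ γ →
    Ribbon n c t → Ribbon n c u → s ∈ u → level s ≡ c → t ≺ᵗ u ⇔ (¬ Meets c (EastOf (proj₁ s)) t)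
  ≺ᵗ-same-level tγ {c} {t} {u} {s} t∈ u∈ r q s∈ e = mk⇔ to from
    where
    open Levels tγ using (distinct⇒Disjoint)
    to : t ≺ᵗ u → ¬ Meets c (EastOf (proj₁ s)) t
    to t≺u m with find m
    ... | z , z∈ , ez , x≤ = <⇒≱
      (≺ᵗ⇒LeftOf r q (distinct⇒Disjoint t∈ u∈ (proj₁ t≺u)) t≺u z s z∈ s∈ (trans ez (sym e))) x≤
    from : ¬ Meets c (EastOf (proj₁ s)) t → t ≺ᵗ u
    from ¬m = LeftOf⇒≺ᵗ r q disj (go (LeftOf-total r q disj))
      where
      disj : Disjoint t u
      disj = distinct⇒Disjoint t∈ u∈ λ { refl → ¬m (lose s∈ (e , ≤-refl)) }
      go : LeftOf t u ⊎ LeftOf u t → LeftOf t u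
      go (inj₁ left) = left
      go (inj₂ right) with Ribbon.square-at r ≤-refl (i<i+n n c)
      ... | z , z∈ , ez = contradiction (lose z∈ (ez , <⇒≤ (right s z s∈ z∈ (trans e (sym ez))))) ¬m

  same-level-transfer : ∀ {c i j t u t′ u′} → IsTile α c i t → IsTile α c j u →
    IsTile β c i t′ → IsTile β c j u′ → t ≺ᵗ u → t′ ≺ᵗ u′
  same-level-transfer {c} {t = t} {u} {t′} {u′} it iu it′ iu′ t≺u =
    compare (α.isTile⇒tile it) (α.isTile⇒tile iu) (β.isTile⇒tile it′) (β.isTile⇒tile iu′)
    where
    open Equivalence
    compare : t ∈ α × Ribbon n c t → u ∈ α × Ribbon n c u →
      t′ ∈ β × Ribbon n c t′ → u′ ∈ β × Ribbon n c u′ → t′ ≺ᵗ u′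
    compare (t∈ , r) (u∈ , q) (t′∈ , r′) (u′∈ , q′)
      with Ribbon.square-at q ≤-refl (i<i+n n c) | Ribbon.square-at q′ ≤-refl (i<i+n n c)
    ... | s , s∈ , e | s′ , s′∈ , e′ = from (≺ᵗ-same-level tβ t′∈ u′∈ r′ q′ s′∈ e′) λ m →
      to (≺ᵗ-same-level tα t∈ u∈ r q s∈ e) t≺u (from meets⇔ m)
      where
      meets⇔ : Meets c (EastOf (proj₁ s)) t ⇔ Meets c (EastOf (proj₁ s′)) t′
      meets⇔ = transfer (meets? c (eastOf? (proj₁ s))) (meets? c (eastOf? (proj₁ s′)))
        (meets-rightward ≤-refl (i<i+n n c) EastOf-rightward)
        (meets-rightward ≤-refl (i<i+n n c) EastOf-rightward)
        (rank-transfer region tα tβ iu iu′ s∈ s′∈ e e′) it it′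

  -- Comparable tiles have squares on levels at most one apart, so c and d differ by at most n, and
  -- being congruent they differ by zero or by n.
  levels-of-comparable : ∀ {c d t u} → c %ℕ n ≡ d %ℕ n → Ribbon n c t → Ribbon n d u → t ≺ᵗ u →
    c ≡ d ⊎ c + + n ≡ d ⊎ d + + n ≡ c
  levels-of-comparable {c} {d} c≡d r q = ≺ᵗ-elim λ {s} {s′} s∈ s′∈ s≺s′ →
    let lo , hi = ≺⇒Near s≺s′ ; c≤ , <c+n = Ribbon.in-range r s∈ ; d≤ , <d+n = Ribbon.in-range q s′∈ in
    decide (≤-trans c≤ (≤-trans lo (below <d+n))) (≤-trans d≤ (≤-trans hi (below <c+n)))
    where
    decide : c ≤ d + + n → d ≤ c + + n → c ≡ d ⊎ c + + n ≡ d ⊎ d + + n ≡ c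
    decide c≤ d≤ with c + + n ≟ d | d + + n ≟ c
    ... | yes e | _     = inj₂ (inj₁ e)
    ... | no _  | yes e = inj₂ (inj₂ e)
    ... | no ≢d | no ≢c = inj₁
      (%-injective n c≡d (≤∧≢⇒< c≤ (λ e → ≢c (sym e))) (≤∧≢⇒< d≤ (λ e → ≢d (sym e))))

  ≺ᵗ-transfer : ∀ {c d i j t u t′ u′} → c %ℕ n ≡ d %ℕ n → IsTile α c i t → IsTile α d j u →
    IsTile β c i t′ → IsTile β d j u′ → t ≺ᵗ u → t′ ≺ᵗ u′
  ≺ᵗ-transfer {c} {d} c≡d it iu it′ iu′ t≺u =
    by-level (levels-of-comparable c≡d (proj₂ (α.isTile⇒tile it)) (proj₂ (α.isTile⇒tile iu)) t≺u)
      it iu it′ iu′ t≺u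
    where
    by-level : ∀ {c d i j t u t′ u′} → c ≡ d ⊎ c + + n ≡ d ⊎ d + + n ≡ c →
      IsTile α c i t → IsTile α d j u → IsTile β c i t′ → IsTile β d j u′ → t ≺ᵗ u → t′ ≺ᵗ u′
    by-level (inj₁ refl) it iu it′ iu′ = same-level-transfer it iu it′ iu′
    by-level {d = d} {j = j} {u = u} {u′ = u′} (inj₂ (inj₁ e)) it iu it′ iu′ =
      -- The lower level of the strip is d - 1, the top level of the tiles of level c.
      proj₁ (facing-transfer {l = ℤ.pred d} (trans e (sym (suc-pred d)))
        it (subst (λ k → IsTile α k j u) (sym (suc-pred d)) iu)
        it′ (subst (λ k → IsTile β k j u′) (sym (suc-pred d)) iu′))
    by-level {c = c} {i = i} {t = t} {t′ = t′} (inj₂ (inj₂ e)) it iu it′ iu′ =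
      -- Now the second tile is the lower one, so the two tiles exchange roles and the other
      -- component applies.
      proj₂ (facing-transfer {l = ℤ.pred c} (trans e (sym (suc-pred c)))
        iu (subst (λ k → IsTile α k i t) (sym (suc-pred c)) it)
        iu′ (subst (λ k → IsTile β k i t′) (sym (suc-pred c)) it′))

lemma1p2 : (n : ℕ) .{{_ : NonZero n}} (R : SquareSet) → SimplyConnectedRegion R →
    (α β : List SquareSet) → RibbonTiling n R α → RibbonTiling n R β →
    (∀ c → length (tilesOfLevel c α) ≡ length (tilesOfLevel c β)
    × (∀ i → IsDefined α c i ⇔ IsDefined β c i))
    × (∀ c d i j → c %ℕ n ≡ d %ℕ n → ∀ {tα uα tβ uβ} →
    IsTile α c i tα → IsTile α d j uα →
    IsTile β c i tβ → IsTile β d j uβ →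
    (tα ≺ᵗ uα) ⇔ (tβ ≺ᵗ uβ))
    × (∀ b → Boundary R b → ∀ c i {tα tβ} →
    IsTile α c i tα → IsTile β c i tβ →
    ((tα ≺ᵗˢ b) ⇔ (tβ ≺ᵗˢ b)) × ((b ≺ˢᵗ tα) ⇔ (b ≺ˢᵗ tβ)))
lemma1p2 n R region α β tα tβ =
  (λ c → αβ.tilesOfLevel-length c , λ i → mk⇔ (αβ.defined c i) (βα.defined c i)) ,
  (λ c d i j c≡d it iu it′ iu′ → mk⇔ (≺ᵗ-transfer region tα tβ c≡d it iu it′ iu′)
                                     (≺ᵗ-transfer region tβ tα c≡d it′ iu′ it iu)) ,
  (λ b boundary c i it it′ →
    mk⇔ (proj₁ (αβ.boundary-transfer boundary it it′)) (proj₁ (βα.boundary-transfer boundary it′ it)) ,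
    mk⇔ (proj₂ (αβ.boundary-transfer boundary it it′)) (proj₂ (βα.boundary-transfer boundary it′ it)))
  where
  module αβ = Pair region tα tβ
  module βα = Pair region tβ tα
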